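{- Let $k \geq 1$ be an integer and let $G$ be a connected $n$-vertex graph such that $(G,k)$ is not special. Let $\mathcal{F} = \mathcal{F}_{0,k} \cup \mathcal{F}_{1,k}$. Then \[\iota(G,\mathcal{F}) \leq \left\lfloor \frac{n}{k+1} \right\rfloor.\] Moreover, equality holds if $G = B_{n,k}$.
   Context: All graphs are finite and simple. For a vertex $v$, $N[v]$ is its closed neighbourhood, and for $D \subseteq V(G)$, $N[D] = \bigcup_{v \in D} N[v]$. Given a set $\mathcal{F}$ of graphs, an $\mathcal{F}$-graph is a graph isomorphic to a member of $\mathcal{F}$. A set $D \subseteq V(G)$ is $\mathcal{F}$-isolating if $G - N[D]$ contains no $\mathcal{F}$-graph as a subgraph, and $\iota(G,\mathcal{F})$ is the minimum size of an $\mathcal{F}$-isolating set of $G$. $K_{1,k}$ denotes the star with $k$ leaves. $\mathcal{F}_{0,k} = \{K_{1,k}\}$, and $\mathcal{F}_{1,k}$ is the set of all regular graphs whose degree is at least $k-1$. The pair $(G,k)$ is called special if either $G$ is a $k$-clique (a copy of $K_k$), or $k = 2$ and $G$ is a $5$-cycle. The graph $B_{n,k}$ ($n,k \geq 1$) is defined as follows: let $q = \lfloor n/(k+1) \rfloor$ and $n = q(k+1) + r$ with $0 \leq r \leq k$. If $q = 0$, $B_{n,k} = K_r$. If $q \geq 1$, take pairwise vertex-disjoint cliques $B_1, \dots, B_q$ on $k+1$ vertices each and $B_{q+1}$ on $r$ vertices; let $q' = q$ if $r = 0$ and $q' = q+1$ if $r \geq 1$; choose $b_i \in V(B_i)$ for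 $i \in [q']$; then $B_{n,k}$ has vertex set $\bigcup_{i=1}^{q'} V(B_i)$ and edge set $\{b_ib_{i+1} : i \in [q'-1]\} \cup \bigcup_{i=1}^{q'} E(B_i)$. -}

module Defs where

open import Data.Fin.Base using (Fin; zero; suc; toℕ)
open import Data.Fin.Properties using () renaming (_≟_ to _≟ᶠ_)
import Data.Fin.Subset as S
open import Data.Fin.Subset using (Subset; ∣_∣; ⁅_⁆; ⋃; ∁)
open import Data.Fin.Subset.Properties using (_∈?_)
open import Data.List.Base using (map; filter; allFin)
open import Data.Nat.Base using (ℕ; suc; _≤_; _∸_; _/_; _%_; NonZero)
open import Data.Nat.Properties using (_≟_)
open import Data.Product.Base using (Σ-syntax; ∃; ∃-syntax; _×_; _,_; proj₁; proj₂)
open import Data.Sum.Base using (_⊎_; swap)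
open import Data.Vec.Base using (tabulate)
open import Function.Base using (_∘_)
open import Function.Bundles using (_↔_; _↣_; _⇔_; module Inverse; module Injection)
open import Level using (Level; 0ℓ; _⊔_) renaming (suc to lsuc)
open import Relation.Binary.Construct.Closure.ReflexiveTransitive using (Star)
open import Relation.Binary.Core using (Rel)
open import Relation.Binary.Definitions using (Symmetric; Irreflexive; Decidable)
open import Relation.Binary.PropositionalEquality using (_≡_; _≢_; refl; sym; ≢-sym)
open import Relation.Nullary using (¬_; does)
open import Relation.Nullary.Decidable using (¬?; _×-dec_; _⊎-dec_)
open import Relation.Unary using (Pred; _∪_; ｛_｝; _∈_)

private
  variable
    ℓ : Level
    V W : Set
    n : ℕ

record Graph (V : Set) : Set₁ where
  infix 4 _~_ _~?_
  field
    _~_      : Rel V 0ℓ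
    _~?_     : Decidable _~_
    ~-sym    : Symmetric _~_
    ~-irrefl : Irreflexive _≡_ _~_

FiniteGraph : Set₁
FiniteGraph = ∃[ n ] Graph (Fin n)

infix 4 _≅_ _⊑_

_≅_ : Graph V → Graph W → Set
_≅_ {V} {W} G H =
  Σ[ f ∈ V ↔ W ] (∀ u v → (u G.~ v) ⇔ (Inverse.to f u H.~ Inverse.to f v))
  where module G = Graph G
        module H = Graph H

-- H is a subgraph of G: the injection plays the role of the inclusion
-- V(H) ⊆ V(G), and edges of H are edges of G.
_⊑_ : Graph W → Graph V → Set
_⊑_ {W} {V} H G =
  Σ[ f ∈ W ↣ V ] (∀ {u v} → u H.~ v → Injection.to f u G.~ Injection.to f v)
  where module G = Graph G
        module H = Graph H

-- The graph with no vertices is not connected.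
Connected : Graph V → Set
Connected {V} G = V × (∀ u v → Star (Graph._~_ G) u v)

-- The subgraph of G induced by the vertices outside X.  Its vertices may be
-- compared by their first components, since membership in a `Subset` is
-- proof-irrelevant.
_−_ : Graph (Fin n) → (X : Subset n) → Graph (∃[ v ] v S.∈ ∁ X)
G − X = record
  { _~_      = λ u v → proj₁ u G.~ proj₁ v
  ; _~?_     = λ u v → proj₁ u G.~? proj₁ v
  ; ~-sym    = G.~-sym
  ; ~-irrefl = λ { refl → G.~-irrefl refl }
  }
  where module G = Graph G

N : Graph (Fin n) → Fin n → Subset n
N G v = tabulate (λ u → does (Graph._~?_ G v u))

N[_∣_] : Graph (Fin n) → Fin n → Subset n
N[ G ∣ v ] = ⁅ v ⁆ S.∪ N G v

N⟦_∣_⟧ : Graph (Fin n) → Subset n → Subset n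
N⟦_∣_⟧ {n} G D = ⋃ (map N[ G ∣_] (filter (_∈? D) (allFin n)))

degree : Graph (Fin n) → Fin n → ℕ
degree G v = ∣ N G v ∣

-- The null graph is excluded: it is a subgraph of every graph, so with it in 𝓕
-- no set would be 𝓕-isolating.
Regular : ℕ → FiniteGraph → Set
Regular d (n , G) = NonZero n × (∀ v → degree G v ≡ d)

-- H is isomorphic to a member of 𝓕.
Is_Graph : Pred FiniteGraph ℓ → FiniteGraph → Set (lsuc 0ℓ ⊔ ℓ)
Is 𝓕 Graph (_ , H) = ∃[ F ] F ∈ 𝓕 × H ≅ proj₂ F

Isolating : Pred FiniteGraph ℓ → Graph (Fin n) → Subset n → Set (lsuc 0ℓ ⊔ ℓ)
Isolating 𝓕 G D = ¬ (∃[ H ] (Is 𝓕 Graph) H × proj₂ H ⊑ (G − N⟦ G ∣ D ⟧))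

-- ι(G, 𝓕) = m.  This is a relation because, for an arbitrary 𝓕, the minimum
-- cannot be computed.
record ι[_,_]≡_ {n} (G : Graph (Fin n)) (𝓕 : Pred FiniteGraph ℓ) (m : ℕ)
       : Set (lsuc 0ℓ ⊔ ℓ) where
  field
    attained : ∃[ D ] Isolating 𝓕 G D × ∣ D ∣ ≡ m
    minimum  : ∀ D → Isolating 𝓕 G D → m ≤ ∣ D ∣

-- Distinct vertices are joined when R relates them in either order.
fromRel : {R : Rel (Fin n) 0ℓ} → Decidable R → Graph (Fin n)
fromRel {R = R} R? = record
  { _~_      = λ u v → u ≢ v × (R u v ⊎ R v u)
  ; _~?_     = λ u v → ¬? (u ≟ᶠ v) ×-dec (R? u v ⊎-dec R? v u)
  ; ~-sym    = λ (u≢v , r) → ≢-sym u≢v , swap r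
  ; ~-irrefl = λ u≡v (u≢v , _) → u≢v u≡v
  }

complete : ∀ n → Graph (Fin n)
complete n = record
  { _~_      = _≢_
  ; _~?_     = λ u v → ¬? (u ≟ᶠ v)
  ; ~-sym    = ≢-sym
  ; ~-irrefl = λ u≡v u≢v → u≢v u≡v
  }

-- K_{1,k}, with centre zero.
star : ∀ k → Graph (Fin (suc k))
star k = fromRel {R = λ u _ → u ≡ zero} (λ u _ → u ≟ᶠ zero)

cycle : ∀ n .{{_ : NonZero n}} → Graph (Fin n)
cycle n = fromRel {R = λ u v → toℕ v ≡ suc (toℕ u) % n}
                  (λ u v → toℕ v ≟ suc (toℕ u) % n)

𝓕₀ : ℕ → Pred FiniteGraph (lsuc 0ℓ)
𝓕₀ k = ｛ suc k , star k ｝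

𝓕₁ : ℕ → Pred FiniteGraph 0ℓ
𝓕₁ k H = ∃[ d ] k ∸ 1 ≤ d × Regular d H

𝓕 : ℕ → Pred FiniteGraph (lsuc 0ℓ)
𝓕 k = 𝓕₀ k ∪ 𝓕₁ k

Special : Graph V → ℕ → Set
Special G k = G ≅ complete k ⊎ (k ≡ 2 × G ≅ cycle 5)

-- B_{n,k}: writing n = q(k+1) + r, the blocks are the runs of k+1 consecutive
-- vertices of Fin n, followed by a last run of r vertices when r > 0.  The chosen
-- vertex bᵢ of a block is its first vertex; other choices give isomorphic
-- graphs.  When q = 0 there is just one block, so the graph is K_r.
module _ (n k : ℕ) where

  block : Fin n → ℕ
  block v = toℕ v / suc k

  position : Fin n → ℕ
  position v = toℕ v % suc k

  B : Graph (Fin n)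
  B = fromRel
    {R = λ u v → block u ≡ block v
               ⊎ (position u ≡ 0 × position v ≡ 0 × block v ≡ suc (block u))}
    (λ u v → (block u ≟ block v)
       ⊎-dec ((position u ≟ 0) ×-dec (position v ≟ 0) ×-dec (block v ≟ suc (block u))))

{-# OPTIONS --safe #-}
module Submission where

-- By induction on |W|, every vertex set W without special components can be
-- isolated by at most |W|/(k+1) vertices.  A disconnected W is split, so let W be
-- connected.  If all degrees are below k, then W is either 𝓕-free or (k−1)-regular
-- with more than k vertices, and then any single vertex isolates it.  If W − x has
-- special components, take x together with one vertex of each of those components
-- that is a pentagon.  Otherwise let v have maximum degree, at least k.  If W − N[v]
-- has no special component, remove N[v].  If it has one, H, then H is attached to two
-- neighbours x and x₂ of v, and both H ∪ {x} and H ∪ {x₂} are covered by few vertices of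
-- H.  Remove one of these sets, unless the components A and A₂ of v in the two remainders
-- are both special; in that case W = A ∪ {x} ∪ H, and x, or v and x with at most one
-- vertex of H, do the job.
--
-- The bound is attained by B n k because an isolating set meets each block of k+1
-- vertices: the non-chosen vertices of a block form a k-clique that is dominated only
-- from within the block.

open import Defs
open import Data.Fin.Base using (Fin; zero; suc; toℕ; fromℕ<; inject≤)
open import Data.Fin.Patterns using (0F; 1F; 2F; 3F; 4F)
open import Data.Fin.Properties as Finₚ using (any?) renaming (_≟_ to _≟ᶠ_)
open import Data.Fin.Subset using (Subset; ∣_∣; ⁅_⁆; ⋃; ∁; _∩_; _∪_; ⊥; ⊤; _∈_; _∉_; _⊆_; Nonempty; inside; outside)
open import Data.Fin.Subset.Properties
open import Data.List.Base as List using (List; []; _∷_; _++_; length)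
open import Data.List.Extrema.Nat using (argmax; argmax-all; f[xs]≤f[argmax])
open import Data.List.Membership.DecPropositional using () renaming (_∈?_ to ∈ˡ-dec)
open import Data.List.Membership.Propositional using () renaming (_∈_ to _∈ˡ_)
open import Data.List.Membership.Propositional.Properties using (∈-filter⁺; ∈-allFin; ∈-lookup; ∈-filter⁻; ∈-map⁺; ∈-map⁻)
open import Data.List.Properties using (length-++)
open import Data.List.Relation.Unary.All as All using (All; []; _∷_)
open import Data.List.Relation.Unary.All.Properties using (all-filter)
open import Data.List.Relation.Unary.AllPairs using ([]; _∷_)
open import Data.List.Relation.Unary.Any as Any using (here; there)
open import Data.List.Relation.Unary.Any.Properties using (lookup-index)
open import Data.List.Relation.Unary.Unique.Propositional using (Unique)
open import Data.Nat.Base using (ℕ; >-nonZero; >-nonZero⁻¹; zero; suc; _+_; _*_; _≤_; _<_; _/_; NonZero; z≤n; s≤s; _∸_; _%_)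
open import Data.Nat.DivMod using (/-monoˡ-≤; m*n/n≡m; m/n*n≤m; [m+kn]%n≡m%n; m<n⇒m%n≡m; m<n⇒m/n≡0; +-distrib-/-∣ʳ)
open import Data.Nat.Divisibility using (divides-refl)
open import Data.Nat.Induction using (<-wellFounded)
open import Data.Nat.Properties
open import Data.Product.Base using (∃-syntax; Σ-syntax; _×_; _,_; proj₁; proj₂)
open import Data.Sum.Base using (_⊎_; inj₁; inj₂)
open import Data.Unit.Base using (tt) renaming (⊤ to Unit)
open import Data.Vec.Base using ([]; _∷_; tabulate; here; there)
open import Data.Vec.Properties using (lookup∘tabulate; []=⇒lookup; lookup⇒[]=)
open import Data.Vec.Properties.WithK using ([]=-irrelevant)
open import Function.Base using (_∘_; id)
open import Function.Bundles using (_⇔_; mk↔ₛ′; mk⇔; mk↣; module Equivalence; module Injection; module Inverse)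
open import Function.Construct.Identity using (↔-id)
open import Induction.WellFounded using (Acc; acc)
open import Level using (0ℓ)
open import Relation.Binary.Construct.Closure.ReflexiveTransitive using (Star; ε; _◅_)
open import Relation.Binary.PropositionalEquality using (_≡_; _≢_; refl; sym; trans; cong; cong₂; subst; subst₂; ≢-sym; module ≡-Reasoning)
open import Relation.Nullary using (¬_; Dec; yes; no; does; contradiction)
open import Relation.Nullary.Decidable using (_×-dec_; _⊎-dec_; _→-dec_; ¬?; dec-true; decidable-stable; True; False; toWitness; toWitnessFalse)
open import Relation.Unary using (Pred; Decidable)

private
  variable
    m n : ℕ
    p q : Subset n
    u v : Fin n

-- Finite subsets: comprehension, difference and cardinality.

⟪_⟫ : {P : Pred (Fin n) 0ℓ} → Decidable P → Subset n
⟪ P? ⟫ = tabulate (λ u → does (P? u))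

module _ {P : Pred (Fin n) 0ℓ} (P? : Decidable P) where

  ∈⟪⟫⁺ : P u → u ∈ ⟪ P? ⟫
  ∈⟪⟫⁺ {u} Pu = lookup⇒[]= u _ (trans (lookup∘tabulate _ u) (dec-true (P? u) Pu))

  ∈⟪⟫⁻ : u ∈ ⟪ P? ⟫ → P u
  ∈⟪⟫⁻ {u} u∈ with P? u | trans (sym (lookup∘tabulate (λ w → does (P? w)) u)) ([]=⇒lookup u∈)
  ... | yes Pu | _ = Pu

infixl 6 _∖_

_∖_ : Subset n → Subset n → Subset n
p ∖ q = p ∩ ∁ q

∈∖⁺ : u ∈ p → u ∉ q → u ∈ p ∖ q
∈∖⁺ u∈p u∉q = x∈p∩q⁺ (u∈p , x∉p⇒x∈∁p u∉q)

∈∖⁻ : ∀ p q → u ∈ p ∖ q → u ∈ p × u ∉ q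
∈∖⁻ p q u∈ with x∈p∩q⁻ p (∁ q) u∈
... | u∈p , u∈∁q = u∈p , x∈∁p⇒x∉p u∈∁q

∣p∩q∣+∣p∖q∣≡∣p∣ : ∀ (p q : Subset n) → ∣ p ∩ q ∣ + ∣ p ∖ q ∣ ≡ ∣ p ∣
∣p∩q∣+∣p∖q∣≡∣p∣ []            []            = refl
∣p∩q∣+∣p∖q∣≡∣p∣ (outside ∷ p) (_ ∷ q)       = ∣p∩q∣+∣p∖q∣≡∣p∣ p q
∣p∩q∣+∣p∖q∣≡∣p∣ (inside ∷ p)  (inside ∷ q)  = cong suc (∣p∩q∣+∣p∖q∣≡∣p∣ p q)
∣p∩q∣+∣p∖q∣≡∣p∣ (inside ∷ p)  (outside ∷ q) =
  trans (+-suc _ _) (cong suc (∣p∩q∣+∣p∖q∣≡∣p∣ p q))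

∣q∣+∣p∖q∣≤∣p∣ : q ⊆ p → ∣ q ∣ + ∣ p ∖ q ∣ ≤ ∣ p ∣
∣q∣+∣p∖q∣≤∣p∣ {q = q} {p} q⊆p = ≤-trans
  (+-monoˡ-≤ _ (p⊆q⇒∣p∣≤∣q∣ {p = q} {q = p ∩ q} λ u∈q → x∈p∩q⁺ (q⊆p u∈q , u∈q)))
  (≤-reflexive (∣p∩q∣+∣p∖q∣≡∣p∣ p q))

∣p∣≤1+∣p∖u∣ : ∀ (p : Subset n) u → ∣ p ∣ ≤ suc ∣ p ∖ ⁅ u ⁆ ∣
∣p∣≤1+∣p∖u∣ p u = ≤-trans
  (≤-reflexive (sym (∣p∩q∣+∣p∖q∣≡∣p∣ p ⁅ u ⁆)))
  (+-monoˡ-≤ _ (≤-trans (∣p∩q∣≤∣q∣ p ⁅ u ⁆) (≤-reflexive (∣⁅x⁆∣≡1 u))))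

⁅⁆⊆ : u ∈ p → ⁅ u ⁆ ⊆ p
⁅⁆⊆ {u = u} u∈p w∈ = subst (_∈ _) (sym (x∈⁅y⁆⇒x≡y u w∈)) u∈p

1+∣p∖u∣≤∣p∣ : u ∈ p → suc ∣ p ∖ ⁅ u ⁆ ∣ ≤ ∣ p ∣
1+∣p∖u∣≤∣p∣ {u = u} {p} u∈p = ≤-trans
  (+-monoˡ-≤ ∣ p ∖ ⁅ u ⁆ ∣ (≤-reflexive (sym (∣⁅x⁆∣≡1 u))))
  (∣q∣+∣p∖q∣≤∣p∣ {q = ⁅ u ⁆} {p} (⁅⁆⊆ u∈p))

nonempty⇒0<∣p∣ : u ∈ p → 0 < ∣ p ∣
nonempty⇒0<∣p∣ u∈p = ≤-trans (s≤s z≤n) (1+∣p∖u∣≤∣p∣ u∈p)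

0<∣p∣⇒nonempty : 0 < ∣ p ∣ → Nonempty p
0<∣p∣⇒nonempty {n} {p} 0<p with nonempty? p
... | yes ne = ne
... | no ¬ne = contradiction (subst (0 <_) (trans (cong ∣_∣ (Empty-unique ¬ne)) (∣⊥∣≡0 n)) 0<p) λ ()

⊆∧∣∣≥⇒⊇ : p ⊆ q → ∣ q ∣ ≤ ∣ p ∣ → q ⊆ p
⊆∧∣∣≥⇒⊇ {p = p} p⊆q q≤p {u} u∈q with u ∈? p
... | yes u∈p = u∈p
... | no  u∉p = contradiction q≤p (<⇒≱ (p⊂q⇒∣p∣<∣q∣ (p⊆q , u , u∈q , u∉p)))

∣∣-injection : (f : Fin m → Fin n) (p : Subset m) (q : Subset n) →
               (∀ {i j} → i ∈ p → j ∈ p → f i ≡ f j → i ≡ j) →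
               (∀ {i} → i ∈ p → f i ∈ q) → ∣ p ∣ ≤ ∣ q ∣
∣∣-injection f []            q inj im = z≤n
∣∣-injection f (outside ∷ p) q inj im = ∣∣-injection (f ∘ suc) p q
  (λ i∈ j∈ eq → Finₚ.suc-injective (inj (there i∈) (there j∈) eq)) (im ∘ there)
∣∣-injection f (inside ∷ p)  q inj im = ≤-trans
  (s≤s (∣∣-injection (f ∘ suc) p (q ∖ ⁅ f zero ⁆)
    (λ i∈ j∈ eq → Finₚ.suc-injective (inj (there i∈) (there j∈) eq))
    (λ i∈ → ∈∖⁺ (im (there i∈)) λ fi∈ →
      contradiction (inj (there i∈) here (x∈⁅y⁆⇒x≡y _ fi∈)) λ ())))
  (1+∣p∖u∣≤∣p∣ (im here))

∣∣-surjection : (f : Fin m → Fin n) (p : Subset m) (q : Subset n) →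
                (∀ {u} → u ∈ q → ∃[ i ] i ∈ p × f i ≡ u) → ∣ q ∣ ≤ ∣ p ∣
∣∣-surjection {n = n} f [] q sur = ≤-reflexive
  (trans (cong ∣_∣ (Empty-unique λ (_ , u∈q) → contradiction (proj₁ (sur u∈q)) λ ())) (∣⊥∣≡0 n))
∣∣-surjection f (outside ∷ p) q sur = ∣∣-surjection (f ∘ suc) p q λ u∈q → shift (sur u∈q)
  where
  shift : ∃[ i ] i ∈ (outside ∷ p) × f i ≡ u → ∃[ i ] i ∈ p × f (suc i) ≡ u
  shift (suc i , there i∈ , eq) = i , i∈ , eq
∣∣-surjection f (inside ∷ p) q sur = ≤-trans (∣p∣≤1+∣p∖u∣ q (f zero))
  (s≤s (∣∣-surjection (f ∘ suc) p (q ∖ ⁅ f zero ⁆) λ u∈ → shift (∈∖⁻ q ⁅ f zero ⁆ u∈)))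
  where
  shift : u ∈ q × u ∉ ⁅ f zero ⁆ → ∃[ i ] i ∈ p × f (suc i) ≡ u
  shift (u∈q , u∉) with sur u∈q
  ... | zero  , _        , refl = contradiction (x∈⁅x⁆ _) u∉
  ... | suc i , there i∈ , eq   = i , i∈ , eq

length≤∣∣ : {us : List (Fin n)} → Unique us → All (_∈ p) us → length us ≤ ∣ p ∣
length≤∣∣ []               []            = z≤n
length≤∣∣ (u≢us ∷ unique) (u∈p ∷ us⊆p) = ≤-trans
  (s≤s (length≤∣∣ unique (All.zipWith
    (λ (w∈p , u≢w) → ∈∖⁺ w∈p λ w∈u → u≢w (sym (x∈⁅y⁆⇒x≡y _ w∈u))) (us⊆p , u≢us))))
  (1+∣p∖u∣≤∣p∣ u∈p)

∣∣≤length : (us : List (Fin n)) → (∀ {u} → u ∈ p → u ∈ˡ us) → ∣ p ∣ ≤ length us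
∣∣≤length {n} []       cover = ≤-reflexive
  (trans (cong ∣_∣ (Empty-unique λ (_ , u∈p) → contradiction (cover u∈p) λ ())) (∣⊥∣≡0 n))
∣∣≤length {p = p} (w ∷ us) cover = ≤-trans (∣p∣≤1+∣p∖u∣ p w)
  (s≤s (∣∣≤length us λ u∈ → drop (∈∖⁻ p ⁅ w ⁆ u∈)))
  where
  drop : u ∈ p × u ∉ ⁅ w ⁆ → u ∈ˡ us
  drop (u∈p , u∉w) with cover u∈p
  ... | here refl = contradiction (x∈⁅x⁆ _) u∉w
  ... | there u∈  = u∈

enumerate : (p : Subset n) → Fin ∣ p ∣ → Fin n
enumerate (outside ∷ p) i       = suc (enumerate p i)
enumerate (inside ∷ p)  zero    = zero
enumerate (inside ∷ p)  (suc i) = suc (enumerate p i)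

enumerate-∈ : (p : Subset n) (i : Fin ∣ p ∣) → enumerate p i ∈ p
enumerate-∈ (outside ∷ p) i       = there (enumerate-∈ p i)
enumerate-∈ (inside ∷ p)  zero    = here
enumerate-∈ (inside ∷ p)  (suc i) = there (enumerate-∈ p i)

enumerate-injective : (p : Subset n) {i j : Fin ∣ p ∣} → enumerate p i ≡ enumerate p j → i ≡ j
enumerate-injective (outside ∷ p) eq = enumerate-injective p (Finₚ.suc-injective eq)
enumerate-injective (inside ∷ p)  {zero}  {zero}  eq = refl
enumerate-injective (inside ∷ p)  {suc i} {suc j} eq =
  cong suc (enumerate-injective p (Finₚ.suc-injective eq))

enumerate-surjective : (p : Subset n) → u ∈ p → ∃[ i ] enumerate p i ≡ u
enumerate-surjective (inside ∷ p)  here       = zero , refl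
enumerate-surjective (outside ∷ p) (there u∈) with enumerate-surjective p u∈
... | i , eq = i , cong suc eq
enumerate-surjective (inside ∷ p)  (there u∈) with enumerate-surjective p u∈
... | i , eq = suc i , cong suc eq

-- Neighbourhoods, degrees and 𝓕-free vertex sets.

module Isolation {n : ℕ} (G : Graph (Fin n)) (k : ℕ) .{{_ : NonZero k}} where

  open Graph G

  ~⇒≢ : u ~ v → u ≢ v
  ~⇒≢ u~v u≡v = ~-irrefl u≡v u~v

  ∈N⁺ : u ~ v → v ∈ N G u
  ∈N⁺ {u} = ∈⟪⟫⁺ (u ~?_)

  ∈N⁻ : v ∈ N G u → u ~ v
  ∈N⁻ {u = u} = ∈⟪⟫⁻ (u ~?_)

  u∈N[u] : u ∈ N[ G ∣ u ]
  u∈N[u] {u} = x∈p∪q⁺ (inj₁ (x∈⁅x⁆ u))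

  ~⇒∈N[] : u ~ v → v ∈ N[ G ∣ u ]
  ~⇒∈N[] u~v = x∈p∪q⁺ (inj₂ (∈N⁺ u~v))

  ∈N[]⁻ : v ∈ N[ G ∣ u ] → v ≡ u ⊎ u ~ v
  ∈N[]⁻ {u = u} v∈ with x∈p∪q⁻ ⁅ u ⁆ (N G u) v∈
  ... | inj₁ v∈u = inj₁ (x∈⁅y⁆⇒x≡y u v∈u)
  ... | inj₂ v∈N = inj₂ (∈N⁻ v∈N)

  deg : Subset n → Fin n → ℕ
  deg S v = ∣ S ∩ N G v ∣

  ∈S∩N : u ∈ p → v ~ u → u ∈ p ∩ N G v
  ∈S∩N u∈p v~u = x∈p∩q⁺ (u∈p , ∈N⁺ v~u)

  ∈S∩N⁻ : ∀ p → u ∈ p ∩ N G v → u ∈ p × v ~ u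
  ∈S∩N⁻ {v = v} p u∈ with x∈p∩q⁻ p (N G v) u∈
  ... | u∈p , u∈N = u∈p , ∈N⁻ u∈N

  deg-mono : (∀ {u} → u ∈ p → v ~ u → u ∈ q) → deg p v ≤ deg q v
  deg-mono {p} {v} p⊆q = p⊆q⇒∣p∣≤∣q∣ λ u∈ →
    let u∈p , v~u = ∈S∩N⁻ p u∈ in ∈S∩N (p⊆q u∈p v~u) v~u

  deg<∣∣ : v ∈ p → suc (deg p v) ≤ ∣ p ∣
  deg<∣∣ {v} {p} v∈p = ≤-trans
    (s≤s (p⊆q⇒∣p∣≤∣q∣ λ u∈ → let u∈p , v~u = ∈S∩N⁻ p u∈ in
      ∈∖⁺ u∈p λ u∈v → ~⇒≢ v~u (sym (x∈⁅y⁆⇒x≡y v u∈v))))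
    (1+∣p∖u∣≤∣p∣ v∈p)

  0<deg⇒neighbour : 0 < deg p v → ∃[ u ] u ∈ p × v ~ u
  0<deg⇒neighbour {p} 0<d with 0<∣p∣⇒nonempty 0<d
  ... | u , u∈ = u , ∈S∩N⁻ p u∈

  1≤k : 1 ≤ k
  1≤k = >-nonZero⁻¹ k

  -- A set of vertices contains no 𝓕-graph exactly when none of its subsets is bad:
  -- the first alternative is a star, and when it fails the second one is a
  -- (k−1)-regular induced subgraph.
  Bad : Subset n → Set
  Bad S = (∃[ v ] v ∈ S × k ≤ deg S v)
        ⊎ (Nonempty S × (∀ {v} → v ∈ S → k ≤ suc (deg S v)))

  bad? : Decidable Bad
  bad? S = any? (λ v → (v ∈? S) ×-dec (k ≤? deg S v))
     ⊎-dec (nonempty? S ×-dec Lift? (λ v → k ≤? suc (deg S v)) S)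

  -- A predicate instead of a subset lets conditions such as being undominated be imposed directly.
  Free : Pred (Fin n) 0ℓ → Set
  Free P = ∀ S → (∀ {u} → u ∈ S → P u) → ¬ Bad S

  bad⇒k≤∣∣ : Bad p → k ≤ ∣ p ∣
  bad⇒k≤∣∣ (inj₁ (v , v∈p , k≤d))      = ≤-trans (m≤n⇒m≤1+n k≤d) (deg<∣∣ v∈p)
  bad⇒k≤∣∣ (inj₂ ((v , v∈p) , k≤1+d)) = ≤-trans (k≤1+d v∈p) (deg<∣∣ v∈p)

  free-mono : {P Q : Pred (Fin n) 0ℓ} → (∀ {u} → P u → Q u) → Free Q → Free P
  free-mono P⊆Q free S S⊆P = free S (P⊆Q ∘ S⊆P)

  free-small : {P : Pred (Fin n) 0ℓ} → (∀ {u} → P u → u ∈ p) → ∣ p ∣ < k → Free P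
  free-small P⊆p ∣p∣<k S S⊆P bad =
    <⇒≱ ∣p∣<k (≤-trans (bad⇒k≤∣∣ bad) (p⊆q⇒∣p∣≤∣q∣ (P⊆p ∘ S⊆P)))

  free-empty : {P : Pred (Fin n) 0ℓ} → (∀ {u} → ¬ P u) → Free P
  free-empty ¬P = free-small {p = ⊥} (λ Pu → contradiction Pu ¬P) (subst (_< k) (sym (∣⊥∣≡0 n)) 1≤k)

  -- The first two hypotheses say that no edge inside `S` crosses the border of `p`, so every vertex
  -- keeps its degree within its own side. A vertex of degree at least `k` makes its side bad; a
  -- lower bound `k − 1` on all degrees passes to `S ∩ p`, which is nonempty.
  bad-∩ : (p : Subset n) {S : Subset n} →
          (∀ {u v} → u ∈ S → v ∈ S → u ∈ p → v ~ u → v ∈ p) →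
          (∀ {u v} → u ∈ S → v ∈ S → u ∈ p → u ~ v → v ∈ p) →
          Nonempty (S ∩ p) → Bad S → Bad (S ∩ p) ⊎ Bad (S ∖ p)
  bad-∩ p {S} into out (w , w∈) bad = split bad
    where
    deg≤ : v ∈ S → v ∈ p → deg S v ≤ deg (S ∩ p) v
    deg≤ v∈S v∈p = deg-mono λ u∈S v~u → x∈p∩q⁺ (u∈S , out v∈S u∈S v∈p v~u)
    deg≤′ : v ∈ S → v ∉ p → deg S v ≤ deg (S ∖ p) v
    deg≤′ v∈S v∉p = deg-mono λ u∈S v~u → ∈∖⁺ u∈S λ u∈p → v∉p (into u∈S v∈S u∈p v~u)
    split : Bad S → Bad (S ∩ p) ⊎ Bad (S ∖ p)
    split (inj₁ (v , v∈S , k≤d)) with v ∈? p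
    ... | yes v∈p = inj₁ (inj₁ (v , x∈p∩q⁺ (v∈S , v∈p) , ≤-trans k≤d (deg≤ v∈S v∈p)))
    ... | no  v∉p = inj₂ (inj₁ (v , ∈∖⁺ v∈S v∉p , ≤-trans k≤d (deg≤′ v∈S v∉p)))
    split (inj₂ (_ , k≤1+d)) = inj₁ (inj₂ ((w , w∈) , λ v∈ →
      let v∈S , v∈p = x∈p∩q⁻ S p v∈ in ≤-trans (k≤1+d v∈S) (s≤s (deg≤ v∈S v∈p))))

  free-∪ : {P : Pred (Fin n) 0ℓ} (p : Subset n) →
           (∀ {u v} → P u → P v → u ∈ p → v ∉ p → ¬ u ~ v) →
           Free (λ u → P u × u ∈ p) → Free (λ u → P u × u ∉ p) → Free P
  free-∪ {P} p sep free₁ free₂ S S⊆P bad with nonempty? (S ∩ p)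
  ... | no empty = free₂ S (λ u∈S → S⊆P u∈S , λ u∈p → empty (_ , x∈p∩q⁺ (u∈S , u∈p))) bad
  ... | yes ne with bad-∩ p
          (λ u∈S v∈S u∈p v~u → into u∈S v∈S u∈p (~-sym v~u)) into ne bad
    where
    into : ∀ {u v} → u ∈ S → v ∈ S → u ∈ p → u ~ v → v ∈ p
    into {v = v} u∈S v∈S u∈p u~v with v ∈? p
    ... | yes v∈p = v∈p
    ... | no  v∉p = contradiction u~v (sep (S⊆P u∈S) (S⊆P v∈S) u∈p v∉p)
  ...   | inj₁ bad∩ = free₁ (S ∩ p) (λ u∈ → let u∈S , u∈p = x∈p∩q⁻ S p u∈ in S⊆P u∈S , u∈p) bad∩
  ...   | inj₂ bad∖ = free₂ (S ∖ p) (λ u∈ → let u∈S , u∉p = ∈∖⁻ S p u∈ in S⊆P u∈S , u∉p) bad∖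

  -- Dominating lists and the combination of partial solutions.

  Undominated : List (Fin n) → Pred (Fin n) 0ℓ
  Undominated D u = All (λ d → u ∉ N[ G ∣ d ]) D

  undominated-++ : ∀ D {D′} → Undominated (D ++ D′) u → Undominated D u × Undominated D′ u
  undominated-++ []      out          = [] , out
  undominated-++ (d ∷ D) (out ∷ outs) with undominated-++ D outs
  ... | out₁ , out₂ = out ∷ out₁ , out₂

  ~⇒dominated : u ~ v → ¬ v ∉ N[ G ∣ u ]
  ~⇒dominated u~v v∉ = v∉ (~⇒∈N[] u~v)

  self-dominated : ¬ u ∉ N[ G ∣ u ]
  self-dominated u∉ = u∉ u∈N[u]

  -- Only the vertices satisfying M count as present.
  Goal : Pred (Fin n) 0ℓ → Subset n → Set
  Goal M W = Σ[ D ∈ List (Fin n) ]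
    suc k * length D ≤ ∣ W ∣ × Free (λ u → u ∈ W × M u × Undominated D u)

  goal-mono : {M M′ : Pred (Fin n) 0ℓ} {W : Subset n} → (∀ {u} → M u → M′ u) → Goal M′ W → Goal M W
  goal-mono M⊆M′ (D , ∣D∣≤ , free) = D , ∣D∣≤ , free-mono (λ (u∈W , Mu , out) → u∈W , M⊆M′ Mu , out) free

  length-++-≤ : ∀ (D D′ : List (Fin n)) {a b c} → suc k * length D ≤ a → suc k * length D′ ≤ b →
                a + b ≤ c → suc k * length (D ++ D′) ≤ c
  length-++-≤ D D′ {a} {b} {c} D≤a D′≤b a+b≤c = begin
    suc k * length (D ++ D′)                ≡⟨ cong (suc k *_) (length-++ D) ⟩
    suc k * (length D + length D′)          ≡⟨ *-distribˡ-+ (suc k) (length D) (length D′) ⟩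
    suc k * length D + suc k * length D′    ≤⟨ +-mono-≤ D≤a D′≤b ⟩
    a + b                                   ≤⟨ a+b≤c ⟩
    c                                       ∎
    where open ≤-Reasoning

  -- The shape of every reduction below: `X` pays for `D`, the remaining vertices pay for `D′`, and
  -- what survives in `X` is not joined to what survives outside. Dominating sets are lists so that
  -- sizes add under concatenation, disjoint or not.
  goal-reduce : {M : Pred (Fin n) 0ℓ} {W : Subset n} (X : Subset n) (D : List (Fin n)) → X ⊆ W →
                suc k * length D ≤ ∣ X ∣ →
                Free (λ u → u ∈ X × M u × Undominated D u) →
                (∀ {u v} → u ∈ X → M u → Undominated D u → v ∈ W → v ∉ X → M v →
                  Undominated D v → ¬ u ~ v) →
                Goal (λ u → M u × Undominated D u) (W ∖ X) → Goal M W
  goal-reduce {M} {W} X D X⊆W ∣D∣≤ free sep (D′ , ∣D′∣≤ , free′) =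
    D ++ D′ , length-++-≤ D D′ ∣D∣≤ ∣D′∣≤ (∣q∣+∣p∖q∣≤∣p∣ X⊆W) ,
    free-∪ X
      (λ (u∈W , Mu , uo) (v∈W , Mv , vo) u∈X v∉X →
        sep u∈X Mu (proj₁ (undominated-++ D uo)) v∈W v∉X Mv (proj₁ (undominated-++ D vo)))
      (free-mono (λ ((u∈W , Mu , uo) , u∈X) → u∈X , Mu , proj₁ (undominated-++ D uo)) free)
      (free-mono (λ ((u∈W , Mu , uo) , u∉X) → let uo₁ , uo₂ = undominated-++ D uo in
        ∈∖⁺ u∈W u∉X , (Mu , uo₁) , uo₂) free′)

  -- Closed sets, connectedness and special sets.

  Closed : Subset n → Subset n → Set
  Closed C W = ∀ {u} → u ∈ C → ∀ {v} → v ∈ W → u ~ v → v ∈ C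

  closed? : ∀ C W → Dec (Closed C W)
  closed? C W = Lift? (λ u → Lift? (λ v → (u ~? v) →-dec (v ∈? C)) W) C

  not-closed : {C W : Subset n} → ¬ Closed C W → ∃[ u ] u ∈ C × (∃[ v ] v ∈ W × u ~ v × v ∉ C)
  not-closed {C} {W} ¬closed
    with any? (λ u → (u ∈? C) ×-dec any? (λ v → (v ∈? W) ×-dec (u ~? v) ×-dec ¬? (v ∈? C)))
  ... | yes edge = edge
  ... | no ¬edge = contradiction
    (λ {u} u∈C {v} v∈W u~v → decidable-stable (v ∈? C) λ v∉C → ¬edge (u , u∈C , v , v∈W , u~v , v∉C))
    ¬closed

  -- Connectedness through closed subsets, not paths: a failure is a subset along which the problem
  -- splits, and it can be found by a finite search.
  Conn : Subset n → Set
  Conn W = ∀ T → T ⊆ W → Nonempty T → Closed T W → W ⊆ T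

  Clique : Subset n → Set
  Clique A = ∣ A ∣ ≡ k × (∀ {u} → u ∈ A → ∀ {v} → v ∈ A → u ≢ v → u ~ v)

  clique? : Decidable Clique
  clique? A = (∣ A ∣ ≟ k) ×-dec
    Lift? (λ u → Lift? (λ v → ¬? (u ≟ᶠ v) →-dec (u ~? v)) A) A

  -- The five non-edges make the cycle induced, and together with the edges they force the five
  -- vertices to be distinct.
  Pentagon : (a b c d e : Fin n) → Subset n → Set
  Pentagon a b c d e A =
      (a ~ b × b ~ c × c ~ d × d ~ e × e ~ a)
    × (¬ a ~ c × ¬ b ~ d × ¬ c ~ e × ¬ d ~ a × ¬ e ~ b)
    × (∀ {u} → u ∈ A → u ∈ˡ (a ∷ b ∷ c ∷ d ∷ e ∷ []))
    × All (_∈ A) (a ∷ b ∷ c ∷ d ∷ e ∷ [])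

  IsPentagon : Subset n → Set
  IsPentagon A = ∃[ a ] ∃[ b ] ∃[ c ] ∃[ d ] ∃[ e ] Pentagon a b c d e A

  isPentagon? : Decidable IsPentagon
  isPentagon? A = any? λ a → any? λ b → any? λ c → any? λ d → any? λ e →
      (a ~? b ×-dec b ~? c ×-dec c ~? d ×-dec d ~? e ×-dec e ~? a)
    ×-dec (¬? (a ~? c) ×-dec ¬? (b ~? d) ×-dec ¬? (c ~? e) ×-dec ¬? (d ~? a) ×-dec ¬? (e ~? b))
    ×-dec Lift? (λ u → ∈ˡ-dec _≟ᶠ_ u (a ∷ b ∷ c ∷ d ∷ e ∷ [])) A
    ×-dec All.all? (_∈? A) (a ∷ b ∷ c ∷ d ∷ e ∷ [])

  Spec : Subset n → Set
  Spec A = Clique A ⊎ (k ≡ 2 × IsPentagon A)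

  spec? : Decidable Spec
  spec? A = clique? A ⊎-dec (k ≟ 2 ×-dec isPentagon? A)

  -- C is a special component of W: special sets are connected, so being closed is enough.
  SpecIn : Subset n → Subset n → Set
  SpecIn C W = Spec C × C ⊆ W × Closed C W

  specIn? : ∀ W → Decidable (λ C → SpecIn C W)
  specIn? W C = spec? C ×-dec (C ⊆? W) ×-dec closed? C W

  -- Symmetries, degrees and domination of special sets.

  pentagon-rotate : ∀ {a b c d e A} → Pentagon a b c d e A → Pentagon b c d e a A
  pentagon-rotate ((ab , bc , cd , de , ea) , (ac , bd , ce , da , eb) , cover , a∷ ∷ b∷ ∷ c∷ ∷ d∷ ∷ e∷ ∷ []) =
    (bc , cd , de , ea , ab) , (bd , ce , da , eb , ac) , move ∘ cover , b∷ ∷ c∷ ∷ d∷ ∷ e∷ ∷ a∷ ∷ []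
    where
    move : ∀ {u a b c d e : Fin n} → u ∈ˡ (a ∷ b ∷ c ∷ d ∷ e ∷ []) → u ∈ˡ (b ∷ c ∷ d ∷ e ∷ a ∷ [])
    move (here eq)                                 = there (there (there (there (here eq))))
    move (there (here eq))                         = here eq
    move (there (there (here eq)))                 = there (here eq)
    move (there (there (there (here eq))))         = there (there (here eq))
    move (there (there (there (there (here eq))))) = there (there (there (here eq)))

  pentagon-reflect : ∀ {a b c d e A} → Pentagon a b c d e A → Pentagon a e d c b A
  pentagon-reflect ((ab , bc , cd , de , ea) , (ac , bd , ce , da , eb) , cover , a∷ ∷ b∷ ∷ c∷ ∷ d∷ ∷ e∷ ∷ []) =
    (~-sym ea , ~-sym de , ~-sym cd , ~-sym bc , ~-sym ab) ,
    (da ∘ ~-sym , ce ∘ ~-sym , bd ∘ ~-sym , ac ∘ ~-sym , eb ∘ ~-sym) ,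
    move ∘ cover , a∷ ∷ e∷ ∷ d∷ ∷ c∷ ∷ b∷ ∷ []
    where
    move : ∀ {u a b c d e : Fin n} → u ∈ˡ (a ∷ b ∷ c ∷ d ∷ e ∷ []) → u ∈ˡ (a ∷ e ∷ d ∷ c ∷ b ∷ [])
    move (here eq)                                 = here eq
    move (there (here eq))                         = there (there (there (there (here eq))))
    move (there (there (here eq)))                 = there (there (there (here eq)))
    move (there (there (there (here eq))))         = there (there (here eq))
    move (there (there (there (there (here eq))))) = there (here eq)

  pentagon-from : ∀ {A} → IsPentagon A → v ∈ A → ∃[ b ] ∃[ c ] ∃[ d ] ∃[ e ] Pentagon v b c d e A
  pentagon-from (a , b , c , d , e , P) v∈A with proj₁ (proj₂ (proj₂ P)) v∈A
  ... | here refl                                 = _ , _ , _ , _ , P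
  ... | there (here refl)                         = _ , _ , _ , _ , pentagon-rotate P
  ... | there (there (here refl))                 = _ , _ , _ , _ , pentagon-rotate (pentagon-rotate P)
  ... | there (there (there (here refl)))         =
    _ , _ , _ , _ , pentagon-rotate (pentagon-rotate (pentagon-rotate P))
  ... | there (there (there (there (here refl)))) =
    _ , _ , _ , _ , pentagon-rotate (pentagon-rotate (pentagon-rotate (pentagon-rotate P)))

  -- After rotating `v` to the front, its neighbours are the second and the fifth vertex; a
  -- reflection exchanges these two.
  pentagon-from-edge : ∀ {A} → IsPentagon A → v ∈ A → u ∈ A → v ~ u →
                       ∃[ c ] ∃[ d ] ∃[ e ] Pentagon v u c d e A
  pentagon-from-edge pent v∈A u∈A v~u with pentagon-from pent v∈A
  ... | b , c , d , e , P@(_ , (v≁c , _ , _ , d≁v , _) , cover , _) with cover u∈A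
  ... | here refl                                 = contradiction v~u (~-irrefl refl)
  ... | there (here refl)                         = _ , _ , _ , P
  ... | there (there (here refl))                 = contradiction v~u v≁c
  ... | there (there (there (here refl)))         = contradiction (~-sym v~u) d≁v
  ... | there (there (there (there (here refl)))) = _ , _ , _ , pentagon-reflect P

  -- Consecutive vertices differ by irreflexivity. If two opposite ones coincided, an edge at one of
  -- them would be an excluded chord at the other.
  pentagon-unique : ∀ {a b c d e A} → Pentagon a b c d e A → Unique (a ∷ b ∷ c ∷ d ∷ e ∷ [])
  pentagon-unique ((ab , bc , cd , de , ea) , (ac , bd , ce , da , eb) , _) =
      (~⇒≢ ab ∷ (λ { refl → da (~-sym cd) }) ∷ (λ { refl → ac (~-sym cd) }) ∷ ≢-sym (~⇒≢ ea) ∷ [])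
    ∷ (~⇒≢ bc ∷ (λ { refl → eb (~-sym de) }) ∷ (λ { refl → bd (~-sym de) }) ∷ [])
    ∷ (~⇒≢ cd ∷ (λ { refl → ac (~-sym ea) }) ∷ [])
    ∷ (~⇒≢ de ∷ [])
    ∷ [] ∷ []

  pentagon-card : ∀ {a b c d e A} → Pentagon a b c d e A → 5 ≤ ∣ A ∣
  pentagon-card P@(_ , _ , _ , members) = length≤∣∣ (pentagon-unique P) members

  clique-degree : ∀ {A} → Clique A → v ∈ A → suc (deg A v) ≡ k
  clique-degree {v} {A} (∣A∣≡k , adj) v∈A = ≤-antisym
    (≤-trans (deg<∣∣ v∈A) (≤-reflexive ∣A∣≡k))
    (≤-trans (≤-reflexive (sym ∣A∣≡k)) (≤-trans (∣p∣≤1+∣p∖u∣ A v) (s≤s (p⊆q⇒∣p∣≤∣q∣ λ u∈ →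
      let u∈A , u∉v = ∈∖⁻ A ⁅ v ⁆ u∈ in
      ∈S∩N u∈A (adj v∈A u∈A λ { refl → u∉v (x∈⁅x⁆ v) })))))

  -- This tells the two kinds of special set apart when `k ≡ 2`: a vertex of a `2`-clique has degree
  -- `1`.
  pentagon-degree : ∀ {A} → IsPentagon A → v ∈ A → deg A v ≡ 2
  pentagon-degree {v} {A} pent v∈A with pentagon-from pent v∈A
  ... | b , c , d , e , P@((vb , bc , cd , de , ev) , (v≁c , b≁d , c≁e , d≁v , e≁b) , cover , _ ∷ b∈ ∷ _ ∷ _ ∷ e∈ ∷ []) =
    ≤-antisym
      (∣∣≤length (b ∷ e ∷ []) neighbours)
      (length≤∣∣ {us = b ∷ e ∷ []} (((λ { refl → b≁d (~-sym de) }) ∷ []) ∷ [] ∷ [])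
        (∈S∩N b∈ vb ∷ ∈S∩N e∈ (~-sym ev) ∷ []))
    where
    neighbours : ∀ {u} → u ∈ A ∩ N G v → u ∈ˡ (b ∷ e ∷ [])
    neighbours u∈ with ∈S∩N⁻ A u∈
    ... | u∈A , v~u with cover u∈A
    ... | here refl                                 = contradiction v~u (~-irrefl refl)
    ... | there (here refl)                         = here refl
    ... | there (there (here refl))                 = contradiction v~u v≁c
    ... | there (there (there (here refl)))         = contradiction (~-sym v~u) d≁v
    ... | there (there (there (there (here refl)))) = there (here refl)

  -- On a pentagon, the vertex opposite to v deals with what is left after removing v.
  spec-opposite : ∀ {H} → Spec H → v ∈ H → Σ[ D ∈ List (Fin n) ]
    suc k * length D + k ≤ ∣ H ∣ × Free (λ u → u ∈ H × u ≢ v × Undominated D u)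
  -- A clique without `v` has `k − 1` vertices, too few for a bad set, so no vertex is spent and the
  -- summand `k` is all of `∣ H ∣`.
  spec-opposite {v} {H} (inj₁ (∣H∣≡k , _)) v∈H =
    [] , ≤-reflexive (trans (cong (_+ k) (*-zeroʳ (suc k))) (sym ∣H∣≡k)) ,
    free-small {p = H ∖ ⁅ v ⁆} (λ (u∈H , u≢v , _) → ∈∖⁺ u∈H (u≢v ∘ x∈⁅y⁆⇒x≡y v))
      (≤-trans (1+∣p∖u∣≤∣p∣ v∈H) (≤-reflexive ∣H∣≡k))
  spec-opposite {v} {H} (inj₂ (k≡2 , pent)) v∈H with pentagon-from pent v∈H
  ... | b , c , d , e , P@((vb , bc , cd , de , ev) , _ , cover , _) =
    -- For `k ≡ 2` the count is `3 * 1 + 2 = 5`. The vertex `c` dominates `b`, `c` and `d`, and `v`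
    -- is excluded, so that only `e` is left.
    c ∷ [] , subst (λ k → suc k * 1 + k ≤ ∣ H ∣) (sym k≡2) (pentagon-card P) ,
    free-small {p = ⁅ e ⁆} rest (subst (∣ ⁅ e ⁆ ∣ <_) (sym k≡2) (s≤s (≤-reflexive (∣⁅x⁆∣≡1 e))))
    where
    rest : ∀ {u} → u ∈ H × u ≢ v × Undominated (c ∷ []) u → u ∈ ⁅ e ⁆
    rest (u∈H , u≢v , out ∷ []) with cover u∈H
    ... | here refl                                 = contradiction refl u≢v
    ... | there (here refl)                         = contradiction out (~⇒dominated (~-sym bc))
    ... | there (there (here refl))                 = contradiction out self-dominated
    ... | there (there (there (here refl)))         = contradiction out (~⇒dominated cd)
    ... | there (there (there (there (here refl)))) = x∈⁅x⁆ e

  -- The extra `1` in the count is for one vertex outside `H` to be removed along with it: `k + 1`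
  -- vertices pay for `v` when `H` is a clique, and six pay for `v` and `c` when it is a pentagon
  -- and `k ≡ 2`.
  spec-dominate : ∀ {H} → Spec H → v ∈ H → Σ[ D ∈ List (Fin n) ]
    suc k * length D ≤ suc ∣ H ∣ × (∀ {u} → u ∈ H ⊎ v ~ u → ¬ Undominated D u)
  spec-dominate {v} {H} (inj₁ (∣H∣≡k , adj)) v∈H =
    v ∷ [] , ≤-reflexive (trans (*-identityʳ (suc k)) (cong suc (sym ∣H∣≡k))) , dominated
    where
    dominated : ∀ {u} → u ∈ H ⊎ v ~ u → ¬ Undominated (v ∷ []) u
    dominated {u} (inj₁ u∈H) (out ∷ []) with v ≟ᶠ u
    ... | yes refl = self-dominated out
    ... | no  v≢u  = ~⇒dominated (adj v∈H u∈H v≢u) out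
    dominated (inj₂ v~u) (out ∷ []) = ~⇒dominated v~u out
  spec-dominate {v} {H} (inj₂ (k≡2 , pent)) v∈H with pentagon-from pent v∈H
  ... | b , c , d , e , P@((vb , bc , cd , de , ev) , _ , cover , _) =
    v ∷ c ∷ [] , subst (λ k → suc k * 2 ≤ suc ∣ H ∣) (sym k≡2) (s≤s (pentagon-card P)) , dominated
    where
    dominated : ∀ {u} → u ∈ H ⊎ v ~ u → ¬ Undominated (v ∷ c ∷ []) u
    dominated (inj₂ v~u) (out ∷ _) = ~⇒dominated v~u out
    dominated (inj₁ u∈H) (out ∷ out′ ∷ []) with cover u∈H
    ... | here refl                                 = self-dominated out
    ... | there (here refl)                         = ~⇒dominated vb out
    ... | there (there (here refl))                 = self-dominated out′
    ... | there (there (there (here refl)))         = ~⇒dominated cd out′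
    ... | there (there (there (there (here refl)))) = ~⇒dominated (~-sym ev) out

  NoSpec : Subset n → Set
  NoSpec W = ∀ {C} → ¬ SpecIn C W

  noSpec? : ∀ W → (∃[ C ] SpecIn C W) ⊎ NoSpec W
  noSpec? W with anySubset? (specIn? W)
  ... | yes found = inj₁ found
  ... | no ¬found = inj₂ λ spec → ¬found (_ , spec)

  closed-trans : ∀ {C T W} → C ⊆ T → Closed C T → Closed T W → Closed C W
  closed-trans C⊆T closedC closedT u∈C v∈W u~v = closedC u∈C (closedT (C⊆T u∈C) v∈W u~v) u~v

  specIn-closed : ∀ {C T W} → T ⊆ W → Closed T W → SpecIn C T → SpecIn C W
  specIn-closed T⊆W closedT (spec , C⊆T , closedC) = spec , T⊆W ∘ C⊆T , closed-trans C⊆T closedC closedT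

  ∖-⊆ : ∀ p (q : Subset n) → p ∖ q ⊆ p
  ∖-⊆ p q = p∩q⊆p p (∁ q)

  closed-∖ : ∀ {T W} → T ⊆ W → Closed T W → Closed (W ∖ T) W
  closed-∖ {T} {W} T⊆W closedT u∈ v∈W u~v with ∈∖⁻ W T u∈
  ... | u∈W , u∉T = ∈∖⁺ v∈W λ v∈T → u∉T (closedT v∈T u∈W (~-sym u~v))

  ∖-< : ∀ {X W : Subset n} → u ∈ X → u ∈ W → ∣ W ∖ X ∣ < ∣ W ∣
  ∖-< {u} {X} {W} u∈X u∈W =
    p⊂q⇒∣p∣<∣q∣ (∖-⊆ W X , u , u∈W , λ u∈ → proj₂ (∈∖⁻ W X u∈) u∈X)

  ∣∣<∣∪⁅⁆∣ : ∀ {H : Subset n} → u ∉ H → suc ∣ H ∣ ≤ ∣ H ∪ ⁅ u ⁆ ∣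
  ∣∣<∣∪⁅⁆∣ {u} {H} u∉H = ≤-trans
    (s≤s (p⊆q⇒∣p∣≤∣q∣ λ w∈H → ∈∖⁺ (x∈p∪q⁺ (inj₁ w∈H)) λ w∈u → u∉H (subst (_∈ H) (x∈⁅y⁆⇒x≡y u w∈u) w∈H)))
    (1+∣p∖u∣≤∣p∣ {u = u} {p = H ∪ ⁅ u ⁆} (x∈p∪q⁺ (inj₂ (x∈⁅x⁆ u))))

  Present : Pred (Fin n) 0ℓ
  Present _ = Unit

  -- The induction step.

  module Step (W : Subset n) (ih : ∀ {W′} → ∣ W′ ∣ < ∣ W ∣ → NoSpec W′ → Goal Present W′)
              (noSpec : NoSpec W) where

    -- No edge of `W` joins `T` to its complement, so a special component of either side would be
    -- one of `W`.
    disconnected : ∀ {T} → T ⊆ W → Nonempty T → Closed T W → ∣ T ∣ < ∣ W ∣ → Goal Present W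
    disconnected {T} T⊆W (t , t∈T) closedT T<W with ih T<W (noSpec ∘ specIn-closed T⊆W closedT)
    ... | D , ∣D∣≤ , free = goal-reduce T D T⊆W ∣D∣≤ free
      (λ u∈T _ _ v∈W v∉T _ _ u~v → v∉T (closedT u∈T v∈W u~v))
      (goal-mono _ (ih (∖-< t∈T (T⊆W t∈T))
        (noSpec ∘ specIn-closed (∖-⊆ W T) (closed-∖ T⊆W closedT))))

    module Connected (conn : Conn W) {w : Fin n} (w∈W : w ∈ W) where

      small-degree : (∀ {u} → u ∈ W → deg W u < k) → Goal Present W
      small-degree deg<k with anySubset? (λ S → (S ⊆? W) ×-dec bad? S)
      ... | no ¬bad = [] , subst (_≤ ∣ W ∣) (sym (*-zeroʳ (suc k))) z≤n ,
                      λ S S⊆ bad → ¬bad (S , (λ u∈S → proj₁ (S⊆ u∈S)) , bad)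
      ... | yes (S , S⊆W , bad) =
        w ∷ [] , subst (_≤ ∣ W ∣) (sym (*-identityʳ (suc k))) k<∣W∣ , rest
        where
        whole : ∀ {S} → S ⊆ W → Bad S → W ⊆ S
        whole S⊆W (inj₁ (u , u∈S , k≤d)) =
          contradiction (≤-trans k≤d (deg-mono λ v∈S _ → S⊆W v∈S)) (<⇒≱ (deg<k (S⊆W u∈S)))
        -- A vertex of `S` has at least `k − 1` neighbours in `S` and at most that many in `W`.
        -- Hence no edge leaves `S`, and connectedness gives all of `W`.
        whole {S} S⊆W (inj₂ (ne , k≤1+d)) = conn S S⊆W ne λ {u} u∈S {v} v∈W u~v →
          proj₁ (∈S∩N⁻ S (⊆∧∣∣≥⇒⊇
            (λ z∈ → let z∈S , u~z = ∈S∩N⁻ S z∈ in ∈S∩N (S⊆W z∈S) u~z)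
            (≤-pred (≤-trans (deg<k (S⊆W u∈S)) (k≤1+d u∈S)))
            (∈S∩N v∈W u~v)))
        k≤1+deg : ∀ {S} → S ⊆ W → Bad S → ∀ {u} → u ∈ W → k ≤ suc (deg W u)
        k≤1+deg S⊆W (inj₁ (u , u∈S , k≤d)) =
          contradiction (≤-trans k≤d (deg-mono λ v∈S _ → S⊆W v∈S)) (<⇒≱ (deg<k (S⊆W u∈S)))
        k≤1+deg S⊆W bad@(inj₂ (_ , k≤1+d)) u∈W =
          ≤-trans (k≤1+d (whole S⊆W bad u∈W)) (s≤s (deg-mono λ v∈S _ → S⊆W v∈S))
        k≤∣W∣ : k ≤ ∣ W ∣
        k≤∣W∣ = ≤-trans (k≤1+deg S⊆W bad w∈W) (deg<∣∣ w∈W)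
        k<∣W∣ : k < ∣ W ∣
        -- With exactly `k` vertices, all of degree at least `k − 1`, `W` would be a clique and a
        -- special component of itself.
        k<∣W∣ = ≤∧≢⇒< k≤∣W∣ λ k≡∣W∣ → noSpec
          (inj₁ (sym k≡∣W∣ , λ {u} u∈W {v} v∈W u≢v →
            proj₂ (∈S∩N⁻ W (⊆∧∣∣≥⇒⊇ {p = W ∩ N G u} {q = W ∖ ⁅ u ⁆}
              (λ z∈ → let z∈W , u~z = ∈S∩N⁻ W z∈ in
                ∈∖⁺ z∈W λ z∈u → ~⇒≢ u~z (sym (x∈⁅y⁆⇒x≡y u z∈u)))
              (≤-pred (≤-trans (1+∣p∖u∣≤∣p∣ u∈W) (≤-trans (≤-reflexive (sym k≡∣W∣)) (k≤1+deg S⊆W bad u∈W))))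
              (∈∖⁺ v∈W λ v∈u → u≢v (sym (x∈⁅y⁆⇒x≡y u v∈u))))))
          , id , λ _ v∈W _ → v∈W)
        rest : Free (λ u → u ∈ W × Unit × Undominated (w ∷ []) u)
        rest S′ S′⊆ bad′ with S′⊆ (whole (proj₁ ∘ S′⊆) bad′ w∈W)
        ... | _ , _ , out ∷ [] = self-dominated out

      -- A vertex whose removal leaves special components.

      module CutVertex {x : Fin n} (x∈W : x ∈ W) where

        -- `C` is not a component of `W`, and only `x` was removed, so an edge leaving `C` must end
        -- at `x`.
        linked : ∀ {C} → SpecIn C (W ∖ ⁅ x ⁆) → ∃[ y ] y ∈ C × x ~ y
        linked {C} (spec , C⊆ , closedC)
          with not-closed {C} {W} (λ closed → noSpec (spec , ∖-⊆ W ⁅ x ⁆ ∘ C⊆ , closed))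
        ... | y , y∈C , z , z∈W , y~z , z∉C with z ≟ᶠ x
        ... | yes refl = y , y∈C , ~-sym y~z
        ... | no  z≢x  = contradiction (closedC y∈C (∈∖⁺ z∈W (z≢x ∘ x∈⁅y⁆⇒x≡y x)) y~z) z∉C

        -- Once `x` is chosen, each special component contains an absent vertex `y`, so
        -- `spec-opposite` settles that component within its own budget. Peeling them off one by one
        -- ends at a set without special components, where the induction hypothesis applies.
        peel : ∀ {W′} → Acc _<_ ∣ W′ ∣ → ∣ W′ ∣ < ∣ W ∣ → (∀ {C} → SpecIn C W′ → ∃[ y ] y ∈ C × x ~ y) →
               Goal (λ u → u ∉ N[ G ∣ x ]) W′
        peel {W′} (acc rec) W′<W link with noSpec? W′
        ... | inj₂ none = goal-mono _ (ih W′<W none)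
        ... | inj₁ (H , specIn@(spec , H⊆ , closedH)) with link specIn
        ... | y , y∈H , x~y with spec-opposite spec y∈H
        ... | D , ∣D∣≤ , free = goal-reduce H D H⊆ (m+n≤o⇒m≤o _ ∣D∣≤)
          (free-mono (λ (u∈H , u∉x , out) → u∈H , (λ { refl → ~⇒dominated x~y u∉x }) , out) free)
          (λ u∈H _ _ v∈W v∉H _ _ u~v → v∉H (closedH u∈H v∈W u~v))
          (goal-mono proj₁ (peel (rec smaller) (<-trans smaller W′<W)
            (link ∘ specIn-closed (∖-⊆ W′ H) (closed-∖ H⊆ closedH))))
          where
          smaller : ∣ W′ ∖ H ∣ < ∣ W′ ∣
          smaller = ∖-< y∈H (H⊆ y∈H)

        goal : ∀ {H} → SpecIn H (W ∖ ⁅ x ⁆) → Goal Present W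
        goal {H} specIn@(spec , H⊆ , closedH) with linked specIn
        ... | y , y∈H , x~y with spec-opposite spec y∈H
        ... | D , ∣D∣≤ , free = goal-reduce X (x ∷ D) X⊆W count
          (free-mono survivors free) separated
          (goal-mono (λ { (_ , out ∷ _) → out })
            -- Special components of `W − X` are also components of `W − x`, since no edge joins
            -- them to the component `H`; so `linked` applies to them.
            (peel (<-wellFounded _) (∖-< (x∈p∪q⁺ (inj₂ (x∈⁅x⁆ x))) x∈W) λ (s , C⊆ , closedC) →
              linked (s , (λ u∈C → let u∈W , u∉X = ∈∖⁻ W X (C⊆ u∈C) in
                                   ∈∖⁺ u∈W (u∉X ∘ q⊆p∪q H ⁅ x ⁆))
                        , λ u∈C v∈ u~v → let u∈W , u∉X = ∈∖⁻ W X (C⊆ u∈C)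
                                             v∈W , v∉x = ∈∖⁻ W ⁅ x ⁆ v∈ in
                            closedC u∈C (∈∖⁺ v∈W λ v∈X → outside-X u∈W u∉X v∉x v∈X u~v) u~v)))
          where
          X : Subset n
          X = H ∪ ⁅ x ⁆
          x∉H : x ∉ H
          x∉H x∈H = proj₂ (∈∖⁻ W ⁅ x ⁆ (H⊆ x∈H)) (x∈⁅x⁆ x)
          outside-X : ∀ {u v} → u ∈ W → u ∉ X → v ∉ ⁅ x ⁆ → v ∈ X → ¬ u ~ v
          outside-X u∈W u∉X v∉x v∈X u~v with x∈p∪q⁻ H ⁅ x ⁆ v∈X
          ... | inj₂ v∈x = v∉x v∈x
          ... | inj₁ v∈H = u∉X (x∈p∪q⁺ (inj₁ (closedH v∈H
                             (∈∖⁺ u∈W (u∉X ∘ q⊆p∪q H ⁅ x ⁆)) (~-sym u~v))))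
          X⊆W : X ⊆ W
          X⊆W u∈X with x∈p∪q⁻ H ⁅ x ⁆ u∈X
          ... | inj₁ u∈H = ∖-⊆ W ⁅ x ⁆ (H⊆ u∈H)
          ... | inj₂ u∈x = subst (_∈ W) (sym (x∈⁅y⁆⇒x≡y x u∈x)) x∈W
          -- The summand `k` left over by `spec-opposite`, together with `x` itself, pays for
          -- choosing `x`.
          count : suc k * length (x ∷ D) ≤ ∣ X ∣
          count = begin
            suc k * suc (length D)       ≡⟨ *-suc (suc k) (length D) ⟩
            suc (k + suc k * length D)   ≡⟨ cong suc (+-comm k _) ⟩
            suc (suc k * length D + k)   ≤⟨ s≤s ∣D∣≤ ⟩
            suc ∣ H ∣                    ≤⟨ ∣∣<∣∪⁅⁆∣ x∉H ⟩
            ∣ X ∣                        ∎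
            where open ≤-Reasoning
          survivors : ∀ {u} → u ∈ X × Unit × Undominated (x ∷ D) u → u ∈ H × u ≢ y × Undominated D u
          survivors (u∈X , _ , out ∷ outs) with x∈p∪q⁻ H ⁅ x ⁆ u∈X
          ... | inj₁ u∈H = u∈H , (λ { refl → ~⇒dominated x~y out }) , outs
          ... | inj₂ u∈x with x∈⁅y⁆⇒x≡y x u∈x
          ...   | refl = contradiction out self-dominated
          separated : ∀ {u v} → u ∈ X → Unit → Undominated (x ∷ D) u → v ∈ W → v ∉ X → Unit →
                      Undominated (x ∷ D) v → ¬ u ~ v
          separated u∈X _ (out ∷ _) v∈W v∉X _ _ u~v = outside-X v∈W v∉X
            (λ u∈x → self-dominated (subst (_∉ N[ G ∣ x ]) (x∈⁅y⁆⇒x≡y x u∈x) out)) u∈X (~-sym u~v)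

      -- A vertex of maximum degree, at least `k`.

      module MaxDegree {v : Fin n} (v∈W : v ∈ W) (deg≤ : ∀ {u} → u ∈ W → deg W u ≤ deg W v)
                       (k≤deg : k ≤ deg W v)
                       (noCut : ∀ {x} → x ∈ W → NoSpec (W ∖ ⁅ x ⁆)) where

        X : Subset n
        X = W ∩ N[ G ∣ v ]

        ∈W∖X : u ∈ W → u ≢ v → ¬ v ~ u → u ∈ W ∖ X
        ∈W∖X u∈W u≢v v≁u = ∈∖⁺ u∈W λ u∈X → not-in (∈N[]⁻ (proj₂ (x∈p∩q⁻ W N[ G ∣ v ] u∈X)))
          where
          not-in : ¬ (_ ≡ v ⊎ v ~ _)
          not-in (inj₁ u≡v) = u≢v u≡v
          not-in (inj₂ v~u) = v≁u v~u

        ∈W∖X⁻ : u ∈ W ∖ X → u ∈ W × u ∉ N[ G ∣ v ]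
        ∈W∖X⁻ u∈ = let u∈W , u∉X = ∈∖⁻ W X u∈ in u∈W , λ u∈N → u∉X (x∈p∩q⁺ (u∈W , u∈N))

        -- The vertex `v` and its neighbours in `W` number at least `k + 1` and are all dominated by
        -- `v`, so nothing of `X` survives.
        take-neighbourhood : NoSpec (W ∖ X) → Goal Present W
        take-neighbourhood none = goal-reduce X (v ∷ []) (p∩q⊆p W N[ G ∣ v ]) count
          (free-empty λ { (u∈X , _ , out ∷ []) → out (in-N u∈X) })
          (λ { u∈X _ (out ∷ []) _ _ _ _ _ → out (in-N u∈X) })
          (goal-mono _ (ih (∖-< {X = X} {W = W} (x∈p∩q⁺ (v∈W , u∈N[u])) v∈W) none))
          where
          in-N : ∀ {u} → u ∈ X → u ∈ N[ G ∣ v ]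
          in-N u∈X = proj₂ (x∈p∩q⁻ W N[ G ∣ v ] u∈X)
          count : suc k * 1 ≤ ∣ X ∣
          count = begin
            suc k * 1       ≡⟨ *-identityʳ (suc k) ⟩
            suc k           ≤⟨ s≤s k≤deg ⟩
            suc (deg W v)   ≤⟨ s≤s (deg-mono {p = W} {v = v} {q = X} λ u∈W v~u → x∈p∩q⁺ (u∈W , ~⇒∈N[] v~u)) ⟩
            suc (deg X v)   ≤⟨ deg<∣∣ (x∈p∩q⁺ (v∈W , u∈N[u])) ⟩
            ∣ X ∣           ∎
            where open ≤-Reasoning

        module Beyond {H : Subset n} (specH : Spec H) (H⊆ : H ⊆ W ∖ X) (closedH : Closed H (W ∖ X)) where

          H⊆W : H ⊆ W
          H⊆W u∈H = proj₁ (∈W∖X⁻ (H⊆ u∈H))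

          H≢v : u ∈ H → u ≢ v
          H≢v u∈H refl = proj₂ (∈W∖X⁻ (H⊆ u∈H)) u∈N[u]

          H≁v : u ∈ H → ¬ v ~ u
          H≁v u∈H v~u = proj₂ (∈W∖X⁻ (H⊆ u∈H)) (~⇒∈N[] v~u)

          exits-to-N[v] : ∀ {u z} → u ∈ H → z ∈ W → u ~ z → z ∈ H ⊎ v ~ z
          exits-to-N[v] {z = z} u∈H z∈W u~z with v ~? z
          ... | yes v~z = inj₂ v~z
          ... | no  v≁z = inj₁ (closedH u∈H (∈W∖X z∈W (λ { refl → H≁v u∈H (~-sym u~z) }) v≁z) u~z)

          -- By `noCut`, `H` is not a component of `W − x`, so some edge leaves `H` while avoiding
          -- `x`. Since `H` is a component of what lies beyond `N[v]`, that edge ends at a neighbour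
          -- of `v`.
          exit : ∀ {x} → x ∈ W → x ∉ H →
                 ∃[ y ] y ∈ H × (∃[ z ] z ∈ W × z ≢ x × v ~ z × y ~ z)
          exit {x} x∈W x∉H with not-closed {H} {W ∖ ⁅ x ⁆} (λ closed → noCut x∈W
                 (specH , (λ u∈H → ∈∖⁺ (H⊆W u∈H) λ u∈x → x∉H (subst (_∈ H) (x∈⁅y⁆⇒x≡y x u∈x) u∈H)) , closed))
          ... | y , y∈H , z , z∈ , y~z , z∉H with ∈∖⁻ W ⁅ x ⁆ z∈
          ... | z∈W , z∉x with exits-to-N[v] y∈H z∈W y~z
          ... | inj₁ z∈H = contradiction z∈H z∉H
          ... | inj₂ v~z = y , y∈H , z , z∈W , (λ { refl → z∉x (x∈⁅x⁆ z) }) , v~z , y~z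

          ∈rest : ∀ {x} → u ∈ W → u ∉ H → u ≢ x → u ∈ W ∖ (H ∪ ⁅ x ⁆)
          ∈rest {u} {x} u∈W u∉H u≢x = ∈∖⁺ u∈W λ u∈X → not-in (x∈p∪q⁻ H ⁅ x ⁆ u∈X)
            where
            not-in : ¬ (u ∈ H ⊎ u ∈ ⁅ x ⁆)
            not-in (inj₁ u∈H) = u∉H u∈H
            not-in (inj₂ u∈x) = u≢x (x∈⁅y⁆⇒x≡y x u∈x)

          ∈rest⁻ : ∀ {x} → u ∈ W ∖ (H ∪ ⁅ x ⁆) → u ∈ W × u ∉ H × u ≢ x
          ∈rest⁻ {u} {x} u∈ = let u∈W , u∉X = ∈∖⁻ W (H ∪ ⁅ x ⁆) u∈ in
            u∈W , u∉X ∘ p⊆p∪q ⁅ x ⁆ , λ { refl → u∉X (q⊆p∪q H ⁅ x ⁆ (x∈⁅x⁆ x)) }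

          -- `spec-dominate` at `y` pays for `H` and `x` together. A special component `A` of the
          -- remainder must contain `v`: an edge from `A` to `H` would start at a neighbour of `v`
          -- and so put `v` into `A`; without such edges `A` is a component of `W − x`, against
          -- `noCut`.
          remove : ∀ {x y} → x ∈ W → v ~ x → y ∈ H → y ~ x →
                   Goal Present W ⊎ (∃[ A ] SpecIn A (W ∖ (H ∪ ⁅ x ⁆)) × v ∈ A)
          remove {x} {y} x∈W v~x y∈H y~x with noSpec? (W ∖ (H ∪ ⁅ x ⁆))
          ... | inj₁ (A , specIn@(specA , A⊆ , closedA)) = inj₂ (A , specIn , decidable-stable (v ∈? A) v∉A⇒⊥)
            where
            v∉A⇒⊥ : ¬ v ∉ A
            v∉A⇒⊥ v∉A = noCut x∈W (specA
              , (λ u∈A → let u∈W , _ , u≢x = ∈rest⁻ (A⊆ u∈A) in ∈∖⁺ u∈W (u≢x ∘ x∈⁅y⁆⇒x≡y x))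
              , λ u∈A z∈ u~z → let u∈W , u∉H , u≢x = ∈rest⁻ (A⊆ u∈A)
                                   z∈W , z∉x = ∈∖⁻ W ⁅ x ⁆ z∈ in
                closedA u∈A (∈rest z∈W (λ z∈H → no-edge u∈A u∈W u∉H (exits-to-N[v] z∈H u∈W (~-sym u~z)))
                                       λ { refl → z∉x (x∈⁅x⁆ x) }) u~z)
              where
              no-edge : ∀ {u} → u ∈ A → u ∈ W → u ∉ H → ¬ (u ∈ H ⊎ v ~ u)
              no-edge u∈A u∈W u∉H (inj₁ u∈H) = u∉H u∈H
              no-edge u∈A u∈W u∉H (inj₂ v~u) = v∉A (closedA u∈A
                (∈rest v∈W (λ v∈H → H≢v v∈H refl) (~⇒≢ v~x)) (~-sym v~u))
          ... | inj₂ none with spec-dominate specH y∈H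
          ... | D , ∣D∣≤ , dominated = inj₁ (goal-reduce (H ∪ ⁅ x ⁆) D X⊆W
            (≤-trans ∣D∣≤ (∣∣<∣∪⁅⁆∣ λ x∈H → H≁v x∈H v~x))
            (free-empty λ (u∈X , _ , out) → dominatedX u∈X out)
            (λ u∈X _ out _ _ _ _ _ → dominatedX u∈X out)
            (goal-mono _ (ih (∖-< {X = H ∪ ⁅ x ⁆} {W = W} (q⊆p∪q H ⁅ x ⁆ (x∈⁅x⁆ x)) x∈W) none)))
            where
            dominatedX : ∀ {u} → u ∈ H ∪ ⁅ x ⁆ → ¬ Undominated D u
            dominatedX u∈X with x∈p∪q⁻ H ⁅ x ⁆ u∈X
            ... | inj₁ u∈H = dominated (inj₁ u∈H)
            ... | inj₂ u∈x = dominated (inj₂ (subst (y ~_) (sym (x∈⁅y⁆⇒x≡y x u∈x)) y~x))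
            X⊆W : H ∪ ⁅ x ⁆ ⊆ W
            X⊆W u∈X with x∈p∪q⁻ H ⁅ x ⁆ u∈X
            ... | inj₁ u∈H = H⊆W u∈H
            ... | inj₂ u∈x = subst (_∈ W) (sym (x∈⁅y⁆⇒x≡y x u∈x)) x∈W

          module Block {x : Fin n} (x∈W : x ∈ W) (v~x : v ~ x) {A : Subset n}
                       (A⊆ : A ⊆ W ∖ (H ∪ ⁅ x ⁆)) (closedA : Closed A (W ∖ (H ∪ ⁅ x ⁆))) (v∈A : v ∈ A) where

            A⊆W : A ⊆ W
            A⊆W u∈A = proj₁ (∈rest⁻ (A⊆ u∈A))

            A∌H : u ∈ A → u ∉ H
            A∌H u∈A = proj₁ (proj₂ (∈rest⁻ (A⊆ u∈A)))

            A≢x : u ∈ A → u ≢ x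
            A≢x u∈A = proj₂ (proj₂ (∈rest⁻ (A⊆ u∈A)))

            grow : ∀ {u z} → u ∈ A → z ∈ W → u ~ z → z ∉ H → z ≢ x → z ∈ A
            grow u∈A z∈W u~z z∉H z≢x = closedA u∈A (∈rest z∈W z∉H z≢x) u~z

            N[v]⊆ : u ∈ W → v ~ u → u ≢ x → u ∈ A
            N[v]⊆ u∈W v~u u≢x = grow v∈A u∈W v~u (λ u∈H → H≁v u∈H v~u) u≢x

            -- Among the neighbours of `v` in `W` only `x` is missing from `A`, because `H` contains
            -- none of them.
            deg-v : deg W v ≡ suc (deg A v)
            deg-v = ≤-antisym
              (≤-trans (∣p∣≤1+∣p∖u∣ (W ∩ N G v) x) (s≤s (p⊆q⇒∣p∣≤∣q∣ λ u∈ →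
                let u∈WN , u∉x = ∈∖⁻ (W ∩ N G v) ⁅ x ⁆ u∈
                    u∈W , v~u = ∈S∩N⁻ W u∈WN in
                ∈S∩N (N[v]⊆ u∈W v~u λ { refl → u∉x (x∈⁅x⁆ x) }) v~u)))
              (≤-trans (s≤s (p⊆q⇒∣p∣≤∣q∣ λ u∈ →
                let u∈A , v~u = ∈S∩N⁻ A u∈ in
                ∈∖⁺ (∈S∩N (A⊆W u∈A) v~u) (A≢x u∈A ∘ x∈⁅y⁆⇒x≡y x)))
                (1+∣p∖u∣≤∣p∣ (∈S∩N x∈W v~x)))

          -- Two exits, each leaving a remainder in which `v` has its own component.

          module TwoExits {x x₂ y : Fin n}
                          (x∈W : x ∈ W) (v~x : v ~ x) (y∈H : y ∈ H) (y~x : y ~ x)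
                          (x₂∈W : x₂ ∈ W) (v~x₂ : v ~ x₂) (x₂≢x : x₂ ≢ x)
                          {A A₂ : Subset n}
                          (A⊆ : A ⊆ W ∖ (H ∪ ⁅ x ⁆)) (closedA : Closed A (W ∖ (H ∪ ⁅ x ⁆))) (v∈A : v ∈ A)
                          (A₂⊆ : A₂ ⊆ W ∖ (H ∪ ⁅ x₂ ⁆)) (closedA₂ : Closed A₂ (W ∖ (H ∪ ⁅ x₂ ⁆))) (v∈A₂ : v ∈ A₂)
                          where

            open Block x∈W v~x A⊆ closedA v∈A
            module Block₂ = Block x₂∈W v~x₂ A₂⊆ closedA₂ v∈A₂

            x₂∈A : x₂ ∈ A
            x₂∈A = N[v]⊆ x₂∈W v~x₂ x₂≢x

            x∈A₂ : x ∈ A₂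
            x∈A₂ = Block₂.N[v]⊆ x∈W v~x (≢-sym x₂≢x)

            x∉H : x ∉ H
            x∉H x∈H = H≁v x∈H v~x

            same-degree : deg A v ≡ deg A₂ v
            same-degree = suc-injective (trans (sym deg-v) Block₂.deg-v)

            -- The union of the three parts is closed, hence all of `W`. Edges from `A` stay by
            -- closedness; edges from `x` lead to `H`, to `x₂`, which is in `A`, or into `A₂`; edges
            -- leaving `H` end at neighbours of `v`.
            three-parts : (∀ {u} → u ∈ A₂ → u ≡ x ⊎ u ∈ A) → u ∈ W → u ∈ A ⊎ u ≡ x ⊎ u ∈ H
            three-parts A₂⊆A u∈W = parts (conn T T⊆W (v , from (inj₁ v∈A)) closedT u∈W)
              where
              T : Subset n
              T = A ∪ (⁅ x ⁆ ∪ H)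
              parts : ∀ {u} → u ∈ T → u ∈ A ⊎ u ≡ x ⊎ u ∈ H
              parts u∈T with x∈p∪q⁻ A (⁅ x ⁆ ∪ H) u∈T
              ... | inj₁ u∈A = inj₁ u∈A
              ... | inj₂ u∈  with x∈p∪q⁻ ⁅ x ⁆ H u∈
              ...   | inj₁ u∈x = inj₂ (inj₁ (x∈⁅y⁆⇒x≡y x u∈x))
              ...   | inj₂ u∈H = inj₂ (inj₂ u∈H)
              from : ∀ {u} → u ∈ A ⊎ u ≡ x ⊎ u ∈ H → u ∈ T
              from (inj₁ u∈A)         = x∈p∪q⁺ (inj₁ u∈A)
              from (inj₂ (inj₁ refl)) = x∈p∪q⁺ (inj₂ (x∈p∪q⁺ (inj₁ (x∈⁅x⁆ x))))
              from (inj₂ (inj₂ u∈H))  = x∈p∪q⁺ (inj₂ (x∈p∪q⁺ (inj₂ u∈H)))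
              T⊆W : T ⊆ W
              T⊆W u∈T with parts u∈T
              ... | inj₁ u∈A         = A⊆W u∈A
              ... | inj₂ (inj₁ refl) = x∈W
              ... | inj₂ (inj₂ u∈H)  = H⊆W u∈H
              step : ∀ {u z} → u ∈ A ⊎ u ≡ x ⊎ u ∈ H → z ∈ W → u ~ z → z ∉ H → z ≢ x → z ∈ A
              step (inj₁ u∈A) z∈W u~z z∉H z≢x = grow u∈A z∈W u~z z∉H z≢x
              step {z = z} (inj₂ (inj₁ refl)) z∈W u~z z∉H z≢x with z ≟ᶠ x₂
              ... | yes refl = x₂∈A
              ... | no  z≢x₂ with A₂⊆A (Block₂.grow x∈A₂ z∈W u~z z∉H z≢x₂)
              ...   | inj₁ z≡x = contradiction z≡x z≢x
              ...   | inj₂ z∈A = z∈A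
              step (inj₂ (inj₂ u∈H)) z∈W u~z z∉H z≢x with exits-to-N[v] u∈H z∈W u~z
              ... | inj₁ z∈H = contradiction z∈H z∉H
              ... | inj₂ v~z = N[v]⊆ z∈W v~z z≢x
              closedT : Closed T W
              closedT u∈T {z} z∈W u~z with z ∈? H | z ≟ᶠ x
              ... | yes z∈H | _       = from (inj₂ (inj₂ z∈H))
              ... | no _    | yes z≡x = from (inj₂ (inj₁ z≡x))
              ... | no z∉H  | no z≢x  = from (inj₁ (step (parts u∈T) z∈W u~z z∉H z≢x))

            -- What survives x lies in {x₂} ∪ (H − y), so it is 𝓕-free unless these k vertices
            -- form a clique.  Then the degree of x₂ forces k = 2, and W is a pentagon.
            clique-case : Clique A → Spec A₂ → Goal Present W
            clique-case cliqueA@(∣A∣≡k , adjA) specA₂ = x ∷ [] , count , λ S S⊆ bad →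
              noSpec (inj₂ (k≡2 S S⊆ bad , pentagon S S⊆ bad) , id , λ _ z∈W _ → z∈W)
              where
              deg-W-v : deg W v ≡ k
              deg-W-v = trans deg-v (clique-degree cliqueA v∈A)
              count : suc k * 1 ≤ ∣ W ∣
              count = begin
                suc k * 1       ≡⟨ *-identityʳ (suc k) ⟩
                suc k           ≤⟨ s≤s k≤deg ⟩
                suc (deg W v)   ≤⟨ deg<∣∣ v∈W ⟩
                ∣ W ∣           ∎
                where open ≤-Reasoning
              deg≤k : u ∈ W → deg W u ≤ k
              deg≤k u∈W = ≤-trans (deg≤ u∈W) (≤-reflexive deg-W-v)

              as-cliqueA₂ : Spec A₂ → Clique A₂
              as-cliqueA₂ (inj₁ clique) = clique
              -- The degree of `v` would be `1` in `A` and `2` in `A₂`.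
              as-cliqueA₂ (inj₂ (k≡2 , pent)) = contradiction
                (trans (sym k≡2) (trans (sym (clique-degree cliqueA v∈A))
                  (cong suc (trans same-degree (pentagon-degree pent v∈A₂))))) λ ()

              cliqueA₂ : Clique A₂
              cliqueA₂ = as-cliqueA₂ specA₂

              as-cliqueH : Spec H → Clique H
              as-cliqueH (inj₁ clique) = clique
              as-cliqueH (inj₂ (k≡2 , pent)) with pentagon-from pent y∈H
              ... | b , c , d , e , (yb , _ , _ , de , ey) , (_ , b≁d , _) , _ , _ ∷ b∈ ∷ _ ∷ _ ∷ e∈ ∷ [] =
                -- Besides its two neighbours on the pentagon, `y` has the neighbour `x`: three,
                -- while the maximum degree is `k ≡ 2`.
                contradiction
                  (length≤∣∣ {us = b ∷ e ∷ x ∷ []}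
                    (((λ { refl → b≁d (~-sym de) }) ∷ (λ { refl → x∉H b∈ }) ∷ []) ∷ ((λ { refl → x∉H e∈ }) ∷ []) ∷ [] ∷ [])
                    (∈S∩N (H⊆W b∈) yb ∷ ∈S∩N (H⊆W e∈) (~-sym ey) ∷ ∈S∩N x∈W y~x ∷ []))
                  (<⇒≱ (s≤s (≤-trans (deg≤k (H⊆W y∈H)) (≤-reflexive k≡2))))

              cliqueH : Clique H
              cliqueH = as-cliqueH specH

              A₂⊆A : ∀ {u} → u ∈ A₂ → u ≡ x ⊎ u ∈ A
              A₂⊆A {u} u∈A₂ with u ≟ᶠ x | u ≟ᶠ v
              ... | yes u≡x | _        = inj₁ u≡x
              ... | no _    | yes refl = inj₂ v∈A
              ... | no u≢x  | no u≢v   =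
                inj₂ (N[v]⊆ (Block₂.A⊆W u∈A₂) (proj₂ cliqueA₂ v∈A₂ u∈A₂ (≢-sym u≢v)) u≢x)

              module _ (S : Subset n) (S⊆ : ∀ {u} → u ∈ S → u ∈ W × Unit × Undominated (x ∷ []) u) (bad : Bad S) where

                survives : u ∈ S → u ∉ N[ G ∣ x ]
                survives u∈S with S⊆ u∈S
                ... | _ , _ , out ∷ [] = out

                S-parts : ∀ {u} → u ∈ S → u ≡ x₂ ⊎ (u ∈ H × u ≢ y)
                S-parts {u} u∈S with three-parts A₂⊆A (proj₁ (S⊆ u∈S))
                ... | inj₂ (inj₁ refl) = contradiction (survives u∈S) self-dominated
                ... | inj₂ (inj₂ u∈H)  = inj₂ (u∈H , λ { refl → ~⇒dominated (~-sym y~x) (survives u∈S) })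
                ... | inj₁ u∈A with u ≟ᶠ x₂
                ...   | yes u≡x₂ = inj₁ u≡x₂
                -- Apart from `x₂`, the clique `A` lies in `A₂`, which is a clique containing `x`;
                -- so `x` dominates it.
                ...   | no  u≢x₂ = contradiction (survives u∈S)
                  (~⇒dominated (proj₂ cliqueA₂ x∈A₂ u∈A₂ (≢-sym (A≢x u∈A))))
                  where
                  u∈A₂ : u ∈ A₂
                  u∈A₂ with u ≟ᶠ v
                  ... | yes refl = v∈A₂
                  ... | no  u≢v  = Block₂.N[v]⊆ (A⊆W u∈A) (adjA v∈A u∈A (≢-sym u≢v)) u≢x₂

                ∣H∖y∣<k : ∣ H ∖ ⁅ y ⁆ ∣ < k
                ∣H∖y∣<k = ≤-trans (1+∣p∖u∣≤∣p∣ y∈H) (≤-reflexive (proj₁ cliqueH))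

                ∈H∖y : u ∈ S → u ≢ x₂ → u ∈ H ∖ ⁅ y ⁆
                ∈H∖y u∈S u≢x₂ with S-parts u∈S
                ... | inj₁ u≡x₂         = contradiction u≡x₂ u≢x₂
                ... | inj₂ (u∈H , u≢y) = ∈∖⁺ u∈H (u≢y ∘ x∈⁅y⁆⇒x≡y y)

                x₂∈S : x₂ ∈ S
                x₂∈S = decidable-stable (x₂ ∈? S) λ x₂∉S → <⇒≱ ∣H∖y∣<k
                  (≤-trans (bad⇒k≤∣∣ bad) (p⊆q⇒∣p∣≤∣q∣ λ u∈S → ∈H∖y u∈S λ { refl → x₂∉S u∈S }))

                ∣S∣≤k : ∣ S ∣ ≤ k
                ∣S∣≤k = ≤-trans (∣p∣≤1+∣p∖u∣ S x₂) (≤-trans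
                  (s≤s (p⊆q⇒∣p∣≤∣q∣ λ u∈ → let u∈S , u∉x₂ = ∈∖⁻ S ⁅ x₂ ⁆ u∈ in
                    ∈H∖y u∈S λ { refl → u∉x₂ (x∈⁅x⁆ x₂) }))
                  ∣H∖y∣<k)

                min-degree : Bad S → k ≤ suc (deg S x₂)
                -- A vertex with `k` neighbours in `S` would need `k + 1` vertices there.
                min-degree (inj₁ (u , u∈S , k≤d)) = contradiction ∣S∣≤k (<⇒≱ (≤-trans (s≤s k≤d) (deg<∣∣ u∈S)))
                min-degree (inj₂ (_ , k≤1+d))     = k≤1+d x₂∈S

                k≤1+deg : k ≤ suc (deg S x₂)
                k≤1+deg = min-degree bad

                -- The neighbours of `x₂` in `S` lie in `H`, so they are disjoint from those in `A`;
                -- together they are bounded by the maximum degree.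
                deg-A+deg-S : deg A x₂ + deg S x₂ ≤ k
                deg-A+deg-S = begin
                  deg A x₂ + deg S x₂                              ≤⟨ +-monoʳ-≤ (deg A x₂) (p⊆q⇒∣p∣≤∣q∣ outside-A) ⟩
                  deg A x₂ + ∣ (W ∩ N G x₂) ∖ (A ∩ N G x₂) ∣       ≤⟨ ∣q∣+∣p∖q∣≤∣p∣ inside-W ⟩
                  deg W x₂                                         ≤⟨ deg≤k x₂∈W ⟩
                  k                                                ∎
                  where
                  open ≤-Reasoning
                  inside-W : A ∩ N G x₂ ⊆ W ∩ N G x₂
                  inside-W u∈ = let u∈A , x₂~u = ∈S∩N⁻ A u∈ in ∈S∩N (A⊆W u∈A) x₂~u
                  outside-A : S ∩ N G x₂ ⊆ (W ∩ N G x₂) ∖ (A ∩ N G x₂)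
                  outside-A u∈ = let u∈S , x₂~u = ∈S∩N⁻ S u∈ in
                    ∈∖⁺ (∈S∩N (proj₁ (S⊆ u∈S)) x₂~u) λ u∈AN →
                      A∌H (proj₁ (∈S∩N⁻ A u∈AN)) (∖-⊆ H ⁅ y ⁆ (∈H∖y u∈S (≢-sym (~⇒≢ x₂~u))))

                k≡1+deg-A : k ≡ suc (deg A x₂)
                k≡1+deg-A = sym (clique-degree cliqueA x₂∈A)

                -- Both summands are at least `k − 1`, so `2(k − 1) ≤ k` and `k − 1 ≤ 1`. The
                -- neighbour `v` of `x₂` in `A` gives `1 ≤ k − 1`.
                k≡2 : k ≡ 2
                k≡2 = trans k≡1+deg-A (cong suc (≤-antisym deg-A≤1 (nonempty⇒0<∣p∣ (∈S∩N v∈A (~-sym v~x₂)))))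
                  where
                  deg-A≤1 : deg A x₂ ≤ 1
                  deg-A≤1 = +-cancelˡ-≤ (deg A x₂) _ _ (begin
                    deg A x₂ + deg A x₂   ≤⟨ +-monoʳ-≤ (deg A x₂) (≤-pred (≤-trans (≤-reflexive (sym k≡1+deg-A)) k≤1+deg)) ⟩
                    deg A x₂ + deg S x₂   ≤⟨ deg-A+deg-S ⟩
                    k                     ≡⟨ k≡1+deg-A ⟩
                    suc (deg A x₂)        ≡⟨ +-comm 1 (deg A x₂) ⟩
                    deg A x₂ + 1          ∎)
                    where open ≤-Reasoning

                at-most-two : ∀ {a b c : Fin n} {p : Subset n} → ∣ p ∣ ≤ k → Unique (a ∷ b ∷ c ∷ []) →
                              ¬ All (_∈ p) (a ∷ b ∷ c ∷ [])
                at-most-two ∣p∣≤k unique ⊆p =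
                  <⇒≱ (s≤s (≤-trans ∣p∣≤k (≤-reflexive k≡2))) (length≤∣∣ unique ⊆p)

                pentagon : IsPentagon W
                pentagon with 0<deg⇒neighbour {p = S} {v = x₂} (≤-pred (≤-trans (≤-reflexive (sym k≡2)) k≤1+deg))
                ... | h , h∈S , x₂~h with S-parts h∈S
                ... | inj₁ refl         = contradiction x₂~h (~-irrefl refl)
                -- The chords at `v` fail because `H` avoids `N[v]`, the chord `h x` because `h`
                -- survives `x`, and the two chords at `x₂` because `x₂` already has the neighbours
                -- `v` and `h`.
                ... | inj₂ (h∈H , h≢y) = v , x₂ , h , y , x ,
                  (v~x₂ , x₂~h , proj₂ cliqueH h∈H y∈H h≢y , y~x , ~-sym v~x) ,
                  ( H≁v h∈H
                  , (λ x₂~y → at-most-two (deg≤k x₂∈W)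
                      ((v≢h ∷ ≢-sym (H≢v y∈H) ∷ []) ∷ (h≢y ∷ []) ∷ [] ∷ [])
                      (∈S∩N v∈W (~-sym v~x₂) ∷ ∈S∩N (H⊆W h∈H) x₂~h ∷ ∈S∩N (H⊆W y∈H) x₂~y ∷ []))
                  , (λ h~x → ~⇒dominated (~-sym h~x) (survives h∈S))
                  , H≁v y∈H ∘ ~-sym
                  , (λ x~x₂ → at-most-two (deg≤k x₂∈W)
                      ((v≢h ∷ ~⇒≢ v~x ∷ []) ∷ ((λ { refl → x∉H h∈H }) ∷ []) ∷ [] ∷ [])
                      (∈S∩N v∈W (~-sym v~x₂) ∷ ∈S∩N (H⊆W h∈H) x₂~h ∷ ∈S∩N x∈W (~-sym x~x₂) ∷ []))) ,
                  cover , v∈W ∷ x₂∈W ∷ H⊆W h∈H ∷ H⊆W y∈H ∷ x∈W ∷ []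
                  where
                  v≢h : v ≢ h
                  v≢h = ≢-sym (H≢v h∈H)
                  cover : ∀ {u} → u ∈ W → u ∈ˡ (v ∷ x₂ ∷ h ∷ y ∷ x ∷ [])
                  cover {u} u∈W with three-parts A₂⊆A u∈W
                  ... | inj₂ (inj₁ refl) = there (there (there (there (here refl))))
                  ... | inj₁ u∈A with u ≟ᶠ v | u ≟ᶠ x₂
                  ...   | yes u≡v | _        = here u≡v
                  ...   | no _    | yes u≡x₂ = there (here u≡x₂)
                  ...   | no u≢v  | no u≢x₂  = contradiction (v∈A ∷ x₂∈A ∷ u∈A ∷ [])
                    (at-most-two (≤-reflexive ∣A∣≡k)
                      ((~⇒≢ v~x₂ ∷ ≢-sym u≢v ∷ []) ∷ (≢-sym u≢x₂ ∷ []) ∷ [] ∷ []))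
                  cover {u} u∈W | inj₂ (inj₂ u∈H) with u ≟ᶠ h | u ≟ᶠ y
                  ... | yes u≡h | _       = there (there (here u≡h))
                  ... | no _    | yes u≡y = there (there (there (here u≡y)))
                  ... | no u≢h  | no u≢y  = contradiction (h∈H ∷ y∈H ∷ u∈H ∷ [])
                    (at-most-two (≤-reflexive (proj₁ cliqueH))
                      ((h≢y ∷ ≢-sym u≢h ∷ []) ∷ (≢-sym u≢y ∷ []) ∷ [] ∷ []))

            -- A = v x₂ c d e and A₂ share v, e, d and c, whence x ~ c; so outside H only d
            -- survives v and x.
            pentagon-case : k ≡ 2 → IsPentagon A → Spec A₂ → Goal Present W
            pentagon-case k≡2 pentA (inj₁ cliqueA₂) = contradiction
              (trans (sym k≡2) (trans (sym (clique-degree cliqueA₂ v∈A₂))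
                (cong suc (trans (sym same-degree) (pentagon-degree pentA v∈A))))) λ ()
            pentagon-case k≡2 pentA (inj₂ (_ , pentA₂))
              with pentagon-from-edge pentA v∈A x₂∈A v~x₂ | pentagon-from-edge pentA₂ v∈A₂ x∈A₂ v~x
            ... | c , d , e , P@((_ , x₂~c , c~d , d~e , e~v) , (v≁c , x₂≁d , c≁e , d≁v , e≁x₂) , coverA , _ ∷ _ ∷ c∈A ∷ d∈A ∷ e∈A ∷ [])
                | b₂ , b₃ , b₄ , (_ , x~b₂ , b₂~b₃ , b₃~b₄ , b₄~v) , (v≁b₂ , x≁b₃ , b₂≁b₄ , b₃≁v , b₄≁x) , coverA₂ , _
              with spec-opposite specH y∈H
            ... | D , ∣D∣≤ , freeH = v ∷ x ∷ D , count ,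
              -- Without `N[v]` the set `H` is cut off. In `H` the vertex `y` is dominated by `x`,
              -- and `D` settles the rest.
              free-∪ H
                (λ { _ (z∈W , _ , out ∷ _) u∈H z∉H u~z → z∉H (closedH u∈H
                  (∈W∖X z∈W (λ { refl → self-dominated out }) (λ v~z → ~⇒dominated v~z out)) u~z) })
                (free-mono (λ { ((_ , _ , _ ∷ out ∷ outs) , u∈H) →
                  u∈H , (λ { refl → ~⇒dominated (~-sym y~x) out }) , outs }) freeH)
                (free-small {p = ⁅ d ⁆} rest (subst (∣ ⁅ d ⁆ ∣ <_) (sym k≡2) (s≤s (≤-reflexive (∣⁅x⁆∣≡1 d)))))
              where
              e∈A₂ : e ∈ A₂
              e∈A₂ = Block₂.N[v]⊆ (A⊆W e∈A) (~-sym e~v) λ { refl → x₂≁d (~-sym d~e) }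
              -- The vertices of `A₂` are matched by walking back along the pentagon `A` from `v`:
              -- first `e`, then `d`, then `c`.
              e≡b₄ : e ≡ b₄
              e≡b₄ with coverA₂ e∈A₂
              ... | here refl                                 = contradiction e~v (~-irrefl refl)
              ... | there (here refl)                         = contradiction refl (A≢x e∈A)
              ... | there (there (here refl))                 = contradiction (~-sym e~v) v≁b₂
              ... | there (there (there (here refl)))         = contradiction e~v b₃≁v
              ... | there (there (there (there (here eq)))) = eq
              d∈A₂ : d ∈ A₂
              d∈A₂ = Block₂.grow e∈A₂ (A⊆W d∈A) (~-sym d~e) (A∌H d∈A) λ { refl → d≁v (~-sym v~x₂) }
              c∈A₂ : c ∈ A₂
              c∈A₂ = Block₂.grow d∈A₂ (A⊆W c∈A) (~-sym c~d) (A∌H c∈A) λ { refl → v≁c v~x₂ }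
              d≡b₃ : d ≡ b₃
              d≡b₃ with coverA₂ d∈A₂
              ... | here refl                                 = contradiction (~-sym c~d) v≁c
              ... | there (here refl)                         = contradiction refl (A≢x d∈A)
              ... | there (there (here refl))                 =
                contradiction (subst (d ~_) e≡b₄ d~e) b₂≁b₄
              ... | there (there (there (here eq)))           = eq
              ... | there (there (there (there (here eq)))) =
                contradiction (subst (d ~_) (trans e≡b₄ (sym eq)) d~e) (~-irrefl refl)
              c≡b₂ : c ≡ b₂
              c≡b₂ with coverA₂ c∈A₂
              ... | here refl                                 = contradiction (~-sym c~d) d≁v
              ... | there (here refl)                         = contradiction refl (A≢x c∈A)
              ... | there (there (here eq))                   = eq
              ... | there (there (there (here eq)))           =
                contradiction (subst (c ~_) (trans d≡b₃ (sym eq)) c~d) (~-irrefl refl)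
              ... | there (there (there (there (here eq)))) =
                contradiction (subst (x₂ ~_) (trans eq (sym e≡b₄)) x₂~c) (e≁x₂ ∘ ~-sym)
              A₂⊆A : ∀ {u} → u ∈ A₂ → u ≡ x ⊎ u ∈ A
              A₂⊆A u∈A₂ with coverA₂ u∈A₂
              ... | here refl                                 = inj₂ v∈A
              ... | there (here refl)                         = inj₁ refl
              ... | there (there (here refl))                 = inj₂ (subst (_∈ A) c≡b₂ c∈A)
              ... | there (there (there (here refl)))         = inj₂ (subst (_∈ A) d≡b₃ d∈A)
              ... | there (there (there (there (here refl)))) = inj₂ (subst (_∈ A) e≡b₄ e∈A)
              rest : ∀ {u} → (u ∈ W × Unit × Undominated (v ∷ x ∷ D) u) × u ∉ H → u ∈ ⁅ d ⁆
              rest ((u∈W , _ , out ∷ out′ ∷ _) , u∉H) with three-parts A₂⊆A u∈W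
              ... | inj₂ (inj₁ refl) = contradiction out′ self-dominated
              ... | inj₂ (inj₂ u∈H)  = contradiction u∈H u∉H
              ... | inj₁ u∈A with coverA u∈A
              ...   | here refl                                 = contradiction out self-dominated
              ...   | there (here refl)                         = contradiction out (~⇒dominated v~x₂)
              ...   | there (there (here refl))                 =
                contradiction out′ (~⇒dominated (subst (x ~_) (sym c≡b₂) x~b₂))
              ...   | there (there (there (here refl)))         = x∈⁅x⁆ d
              ...   | there (there (there (there (here refl)))) = contradiction out (~⇒dominated (~-sym e~v))
              -- For `k ≡ 2`, the vertices `v` and `x` cost six: `x` and the five vertices of `A`,
              -- all outside `H`.
              six : 6 ≤ ∣ W ∖ H ∣
              six = length≤∣∣ {us = x ∷ v ∷ x₂ ∷ c ∷ d ∷ e ∷ []}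
                (All.map (λ u∈A → ≢-sym (A≢x u∈A)) members ∷ pentagon-unique P)
                (∈∖⁺ x∈W x∉H ∷ All.map (λ u∈A → ∈∖⁺ (A⊆W u∈A) (A∌H u∈A)) members)
                where
                members : All (_∈ A) (v ∷ x₂ ∷ c ∷ d ∷ e ∷ [])
                members = v∈A ∷ x₂∈A ∷ c∈A ∷ d∈A ∷ e∈A ∷ []
              count : suc k * (2 + length D) ≤ ∣ W ∣
              count = begin
                suc k * (2 + length D)              ≡⟨ *-distribˡ-+ (suc k) 2 (length D) ⟩
                suc k * 2 + suc k * length D        ≡⟨ cong (λ k → suc k * 2 + suc k * length D) k≡2 ⟩
                6 + 3 * length D                    ≡⟨ cong (λ k → 6 + suc k * length D) (sym k≡2) ⟩
                6 + suc k * length D                ≤⟨ +-mono-≤ six (m+n≤o⇒m≤o (suc k * length D) ∣D∣≤) ⟩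
                ∣ W ∖ H ∣ + ∣ H ∣                   ≡⟨ +-comm ∣ W ∖ H ∣ ∣ H ∣ ⟩
                ∣ H ∣ + ∣ W ∖ H ∣                   ≤⟨ ∣q∣+∣p∖q∣≤∣p∣ H⊆W ⟩
                ∣ W ∣                               ∎
                where open ≤-Reasoning

          goal : Goal Present W
          -- The second call of `exit` avoids the first exit `x`, so `x₂` differs from `x`; avoiding
          -- `v` in the first call only yields some exit.
          goal with exit v∈W (λ v∈H → H≢v v∈H refl)
          ... | y , y∈H , x , x∈W , _ , v~x , y~x with exit x∈W (λ x∈H → H≁v x∈H v~x)
          ... | y₂ , y₂∈H , x₂ , x₂∈W , x₂≢x , v~x₂ , y₂~x₂
            with remove x∈W v~x y∈H y~x | remove x₂∈W v~x₂ y₂∈H y₂~x₂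
          ... | inj₁ done | _ = done
          ... | inj₂ _ | inj₁ done = done
          ... | inj₂ (A , (inj₁ clique , A⊆ , closedA) , v∈A) | inj₂ (A₂ , (specA₂ , A₂⊆ , closedA₂) , v∈A₂) =
            TwoExits.clique-case x∈W v~x y∈H y~x x₂∈W v~x₂ x₂≢x A⊆ closedA v∈A A₂⊆ closedA₂ v∈A₂ clique specA₂
          ... | inj₂ (A , (inj₂ (k≡2 , pent) , A⊆ , closedA) , v∈A) | inj₂ (A₂ , (specA₂ , A₂⊆ , closedA₂) , v∈A₂) =
            TwoExits.pentagon-case x∈W v~x y∈H y~x x₂∈W v~x₂ x₂≢x A⊆ closedA v∈A A₂⊆ closedA₂ v∈A₂ k≡2 pent specA₂

        goal : Goal Present W
        goal with noSpec? (W ∖ X)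
        ... | inj₁ (H , specH , H⊆ , closedH) = Beyond.goal specH H⊆ closedH
        ... | inj₂ none = take-neighbourhood none

      max-degree : ∃[ v ] v ∈ W × (∀ {u} → u ∈ W → deg W u ≤ deg W v)
      -- `w` is the default value of `argmax`; it belongs to `W` like all listed vertices, hence so
      -- does the maximiser.
      max-degree = argmax (deg W) w vertices ,
        argmax-all (deg W) w∈W (all-filter (_∈? W) (List.allFin n)) ,
        λ {u} u∈W → All.lookup (f[xs]≤f[argmax] {f = deg W} w vertices) (∈-filter⁺ (_∈? W) (∈-allFin u) u∈W)
        where
        vertices : List (Fin n)
        vertices = List.filter (_∈? W) (List.allFin n)

      goal : Goal Present W
      goal with max-degree
      ... | v , v∈W , deg≤ with k ≤? deg W v
      ... | no  k≰deg = small-degree λ u∈W → ≤-<-trans (deg≤ u∈W) (≰⇒> k≰deg)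
      ... | yes k≤deg with any? (λ x → (x ∈? W) ×-dec anySubset? (specIn? (W ∖ ⁅ x ⁆)))
      ...   | yes (x , x∈W , H , specIn) = CutVertex.goal x∈W specIn
      ...   | no  noCut = MaxDegree.goal v∈W deg≤ k≤deg λ x∈W specIn → noCut (_ , x∈W , _ , specIn)

    goal : Goal Present W
    goal with nonempty? W
    ... | no empty = [] , subst (_≤ ∣ W ∣) (sym (*-zeroʳ (suc k))) z≤n ,
                     free-empty λ (u∈W , _) → empty (_ , u∈W)
    -- If no nonempty closed subset is smaller than `W`, every such subset has full size and
    -- therefore contains `W`, which is `Conn W`.
    ... | yes (w , w∈W) with anySubset? (λ T → (T ⊆? W) ×-dec nonempty? T ×-dec closed? T W ×-dec (∣ T ∣ <? ∣ W ∣))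
    ...   | yes (T , T⊆W , ne , closed , T<W) = disconnected T⊆W ne closed T<W
    ...   | no  whole = Connected.goal
      (λ T T⊆W ne closed → ⊆∧∣∣≥⇒⊇ T⊆W (≮⇒≥ λ T<W → whole (T , T⊆W , ne , closed , T<W))) w∈W

  upper-bound : ∀ {W} → Acc _<_ ∣ W ∣ → NoSpec W → Goal Present W
  upper-bound {W} (acc rec) noSpec = Step.goal W (λ W′<W → upper-bound (rec W′<W)) noSpec

-- Closed neighbourhoods of sets, isomorphisms and smallest subsets.

∈⋃⁺ : {ps : List (Subset n)} → p ∈ˡ ps → u ∈ p → u ∈ ⋃ ps
∈⋃⁺ (here refl)  u∈p = x∈p∪q⁺ (inj₁ u∈p)
∈⋃⁺ (there p∈ps) u∈p = x∈p∪q⁺ (inj₂ (∈⋃⁺ p∈ps u∈p))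

∈⋃⁻ : (ps : List (Subset n)) → u ∈ ⋃ ps → ∃[ p ] p ∈ˡ ps × u ∈ p
∈⋃⁻ []       u∈ = contradiction u∈ ∉⊥
∈⋃⁻ (p ∷ ps) u∈ with x∈p∪q⁻ p (⋃ ps) u∈
... | inj₁ u∈p = p , here refl , u∈p
... | inj₂ u∈⋃ with ∈⋃⁻ ps u∈⋃
...   | q , q∈ps , u∈q = q , there q∈ps , u∈q

∈N⟦⟧⁺ : (G : Graph (Fin n)) (D : Subset n) → v ∈ D → u ∈ N[ G ∣ v ] → u ∈ N⟦ G ∣ D ⟧
∈N⟦⟧⁺ {v = v} G D v∈D = ∈⋃⁺ (∈-map⁺ N[ G ∣_] (∈-filter⁺ (_∈? D) (∈-allFin v) v∈D))

∈N⟦⟧⁻ : (G : Graph (Fin n)) (D : Subset n) → u ∈ N⟦ G ∣ D ⟧ → ∃[ v ] v ∈ D × u ∈ N[ G ∣ v ]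
∈N⟦⟧⁻ G D u∈ with ∈⋃⁻ (List.map N[ G ∣_] (List.filter (_∈? D) (List.allFin _))) u∈
... | _ , p∈ , u∈p with ∈-map⁻ N[ G ∣_] p∈
...   | v , v∈ , refl = v , proj₂ (∈-filter⁻ (_∈? D) {xs = List.allFin _} v∈) , u∈p

≅-refl : {V : Set} (G : Graph V) → G ≅ G
≅-refl G = ↔-id _ , λ _ _ → mk⇔ id id

lookup-injective : {A : Set} {xs : List A} → Unique xs → ∀ i j → List.lookup xs i ≡ List.lookup xs j → i ≡ j
lookup-injective (_ ∷ _)      zero    zero    _  = refl
lookup-injective (x≢ ∷ _)     zero    (suc j) eq = contradiction eq (All.lookup x≢ (∈-lookup j))
lookup-injective (x≢ ∷ _)     (suc i) zero    eq = contradiction (sym eq) (All.lookup x≢ (∈-lookup i))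
lookup-injective (_ ∷ unique) (suc i) (suc j) eq = cong suc (lookup-injective unique i j eq)

complete-≅ : (G : Graph (Fin n)) {k : ℕ} → n ≡ k → (∀ u v → u ≢ v → Graph._~_ G u v) → G ≅ complete k
complete-≅ G refl adj = ↔-id _ , λ u v → mk⇔ (λ u~v u≡v → Graph.~-irrefl G u≡v u~v) (adj u v)

smallest : {Q : Pred (Subset n) 0ℓ} → Decidable Q → ∀ D → Acc _<_ ∣ D ∣ → Q D →
           ∃[ D′ ] Q D′ × ∣ D′ ∣ ≤ ∣ D ∣ × (∀ E → Q E → ∣ D′ ∣ ≤ ∣ E ∣)
smallest Q? D (acc rec) QD with anySubset? (λ E → Q? E ×-dec (∣ E ∣ <? ∣ D ∣))
... | no  none = D , QD , ≤-refl , λ E QE → ≮⇒≥ λ E<D → none (E , QE , E<D)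
... | yes (E , QE , E<D) with smallest Q? E (rec E<D) QE
...   | D′ , QD′ , D′≤E , least = D′ , QD′ , ≤-trans D′≤E (<⇒≤ E<D) , least

-- Isolating sets and 𝓕-free remainders.

module IsolatingSets {n : ℕ} (G : Graph (Fin n)) (k : ℕ) .{{_ : NonZero k}} where

  open Graph G
  open Isolation G k

  Rest : Subset n → Subset n
  Rest D = ∁ N⟦ G ∣ D ⟧

  -- `Isolating` speaks of arbitrary finite graphs, while freeness only concerns the finitely many
  -- subsets of vertices. Being decidable, it allows a smallest isolating set to be found by search.
  rest-free? : Decidable (λ D → Free (_∈ Rest D))
  rest-free? D with anySubset? (λ S → (S ⊆? Rest D) ×-dec bad? S)
  ... | yes (S , S⊆ , bad) = no λ free → free S S⊆ bad
  ... | no  none           = yes λ S S⊆ bad → none (S , S⊆ , bad)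

  module Copy {D : Subset n} {m : ℕ} (F : Graph (Fin m)) (f : Fin m → Fin n)
              (f-injective : ∀ {i j} → f i ≡ f j → i ≡ j) (f-∈ : ∀ i → f i ∈ Rest D)
              (f-~ : ∀ {i j} → Graph._~_ F i j → f i ~ f j) where

    image : Subset n
    image = ⟪ (λ u → any? λ i → f i ≟ᶠ u) ⟫

    ∈image⁺ : ∀ i → f i ∈ image
    ∈image⁺ i = ∈⟪⟫⁺ (λ u → any? λ i → f i ≟ᶠ u) (i , refl)

    ∈image⁻ : u ∈ image → ∃[ i ] f i ≡ u
    ∈image⁻ = ∈⟪⟫⁻ (λ u → any? λ i → f i ≟ᶠ u)

    image⊆Rest : image ⊆ Rest D
    image⊆Rest u∈ with ∈image⁻ u∈
    ... | i , refl = f-∈ i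

    degree≤ : ∀ i → degree F i ≤ deg image (f i)
    degree≤ i = ∣∣-injection f (N F i) (image ∩ N G (f i)) (λ _ _ → f-injective)
      λ {j} j∈ → ∈S∩N (∈image⁺ j) (f-~ (∈⟪⟫⁻ (Graph._~?_ F i) j∈))

  -- The vertices of a copy of a member of `𝓕 k` form a bad set: the centre of a star has `k`
  -- neighbours in it, and in a regular graph every degree is at least `k − 1`. Further edges of `G`
  -- between these vertices only raise the degrees.
  free⇒isolating : ∀ {D} → Free (_∈ Rest D) → Isolating (𝓕 k) G D
  free⇒isolating {D} free ((_ , H) , ((m , F) , F∈𝓕 , iso , iso-~) , f , f-~) = not-in-𝓕 F∈𝓕
    where
    g : Fin m → Fin n
    g i = proj₁ (Injection.to f (Inverse.from iso i))
    g-injective : ∀ {i j} → g i ≡ g j → i ≡ j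
    g-injective {i} {j} eq = trans (sym (Inverse.strictlyInverseˡ iso i))
      (trans (cong (Inverse.to iso) (Injection.injective f (∃-≡ eq))) (Inverse.strictlyInverseˡ iso j))
      where
      ∃-≡ : {a b : ∃[ v ] v ∈ Rest D} → proj₁ a ≡ proj₁ b → a ≡ b
      ∃-≡ {v , v∈} {.v , v∈′} refl = cong (v ,_) ([]=-irrelevant v∈ v∈′)
    g-~ : ∀ {i j} → Graph._~_ F i j → g i ~ g j
    g-~ {i} {j} i~j = f-~ (Equivalence.from (iso-~ (Inverse.from iso i) (Inverse.from iso j))
      (subst₂ (Graph._~_ F) (sym (Inverse.strictlyInverseˡ iso i)) (sym (Inverse.strictlyInverseˡ iso j)) i~j))
    open Copy {D} F g g-injective (λ i → proj₂ (Injection.to f (Inverse.from iso i))) g-~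

    not-in-𝓕 : ¬ 𝓕 k (m , F)
    not-in-𝓕 (inj₁ refl) = free image image⊆Rest (inj₁ (g zero , ∈image⁺ zero , ≤-trans
      (≤-reflexive (sym (∣⊤∣≡n k)))
      (∣∣-injection (g ∘ suc) ⊤ (image ∩ N G (g zero)) (λ _ _ → Finₚ.suc-injective ∘ g-injective)
        λ {j} _ → ∈S∩N (∈image⁺ (suc j)) (g-~ {zero} {suc j} ((λ ()) , inj₁ refl)))))
    not-in-𝓕 (inj₂ (d , k∸1≤d , m≢0 , regular)) = free image image⊆Rest
      (inj₂ ((g first , ∈image⁺ first) , λ u∈ → large (∈image⁻ u∈)))
      where
      first : Fin m
      first = fromℕ< (>-nonZero⁻¹ m {{m≢0}})
      large : ∀ {u} → ∃[ i ] g i ≡ u → k ≤ suc (deg image u)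
      large (i , refl) = ≤-trans (m≤n+m∸n k 1)
        (s≤s (≤-trans k∸1≤d (≤-trans (≤-reflexive (sym (regular i))) (degree≤ i))))

  -- A vertex of degree at least `k` in `S` carries a star. Once stars are excluded, the lower bound
  -- `k − 1` on the degrees is attained everywhere, so `S` induces a regular graph belonging to
  -- `𝓕₁ k`.
  isolating⇒free : ∀ {D} → Isolating (𝓕 k) G D → Free (_∈ Rest D)
  isolating⇒free {D} isolating S S⊆ bad = by-bad bad
    where
    no-star : ∀ {v} → v ∈ S → ¬ k ≤ deg S v
    no-star {v} v∈S k≤d = isolating ((suc k , star k) , ((suc k , star k) , inj₁ refl , ≅-refl (star k)) ,
      mk↣ {to = λ i → f i , f-∈ i} (λ {i} {j} eq → f-injective i j (cong proj₁ eq)) ,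
      λ {i} {j} → f-~ {i} {j})
      where
      leaf : Fin k → Fin n
      leaf j = enumerate (S ∩ N G v) (inject≤ j k≤d)
      leaf-∈ : ∀ j → leaf j ∈ S × v ~ leaf j
      leaf-∈ j = ∈S∩N⁻ S (enumerate-∈ (S ∩ N G v) (inject≤ j k≤d))
      f : Fin (suc k) → Fin n
      f zero    = v
      f (suc j) = leaf j
      f-∈ : ∀ i → f i ∈ Rest D
      f-∈ zero    = S⊆ v∈S
      f-∈ (suc j) = S⊆ (proj₁ (leaf-∈ j))
      f-injective : ∀ i j → f i ≡ f j → i ≡ j
      f-injective zero    zero    eq = refl
      f-injective zero    (suc j) eq = contradiction eq (~⇒≢ (proj₂ (leaf-∈ j)))
      f-injective (suc i) zero    eq = contradiction (sym eq) (~⇒≢ (proj₂ (leaf-∈ i)))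
      f-injective (suc i) (suc j) eq = cong suc
        (Finₚ.inject≤-injective k≤d k≤d i j (enumerate-injective (S ∩ N G v) eq))
      f-~ : ∀ {i j} → Graph._~_ (star k) i j → f i ~ f j
      f-~ {zero}  {zero}  (0≢0 , _)      = contradiction refl 0≢0
      f-~ {zero}  {suc j} _              = proj₂ (leaf-∈ j)
      f-~ {suc i} {zero}  _              = ~-sym (proj₂ (leaf-∈ i))
      f-~ {suc i} {suc j} (_ , inj₁ ())
      f-~ {suc i} {suc j} (_ , inj₂ ())
    by-bad : ¬ Bad S
    by-bad (inj₁ (v , v∈S , k≤d)) = no-star v∈S k≤d
    by-bad (inj₂ ((w , w∈S) , k≤1+d)) = isolating ((∣ S ∣ , H) ,
      ((∣ S ∣ , H) , inj₂ (k ∸ 1 , ≤-refl , >-nonZero (nonempty⇒0<∣p∣ w∈S) , regular) , ≅-refl H) ,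
      mk↣ {to = λ i → e i , S⊆ (enumerate-∈ S i)} (λ eq → enumerate-injective S (cong proj₁ eq)) , id)
      where
      e : Fin ∣ S ∣ → Fin n
      e = enumerate S
      H : Graph (Fin ∣ S ∣)
      H = record
        { _~_      = λ i j → e i ~ e j
        ; _~?_     = λ i j → e i ~? e j
        ; ~-sym    = ~-sym
        ; ~-irrefl = λ i≡j → ~-irrefl (cong e i≡j)
        }
      regular : ∀ i → degree H i ≡ k ∸ 1
      regular i = trans
        (≤-antisym
          (∣∣-injection e (N H i) (S ∩ N G (e i)) (λ _ _ → enumerate-injective S)
            λ {j} j∈ → ∈S∩N (enumerate-∈ S j) (∈⟪⟫⁻ (Graph._~?_ H i) j∈))
          (∣∣-surjection e (N H i) (S ∩ N G (e i)) preimage))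
        (cong (_∸ 1) (≤-antisym (≰⇒> (no-star (enumerate-∈ S i))) (k≤1+d (enumerate-∈ S i))))
        where
        preimage : ∀ {u} → u ∈ S ∩ N G (e i) → ∃[ j ] j ∈ N H i × e j ≡ u
        preimage u∈ with ∈S∩N⁻ S u∈
        ... | u∈S , ei~u with enumerate-surjective S u∈S
        ...   | j , refl = j , ∈⟪⟫⁺ (Graph._~?_ H i) ei~u , refl

  -- From special vertex sets to special graphs.

  pentagon-≅ : ∀ {a b c d e} → Pentagon a b c d e ⊤ → G ≅ cycle 5
  pentagon-≅ {a} {b} {c} {d} {e} P@((ab , bc , cd , de , ea) , (ac , bd , ce , da , eb) , cover , _) =
    mk↔ₛ′ to from (λ i → from-injective (from-to (from i))) from-to ,
    λ u v → subst₂ (λ x y → x ~ y ⇔ Graph._~_ (cycle 5) (to u) (to v)) (from-to u) (from-to v) (adjacent (to u) (to v))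
    where
    vertices : List (Fin n)
    vertices = a ∷ b ∷ c ∷ d ∷ e ∷ []
    from : Fin 5 → Fin n
    from = List.lookup vertices
    to : Fin n → Fin 5
    to u = Any.index (cover (∈⊤ {x = u}))
    from-to : ∀ u → from (to u) ≡ u
    from-to u = sym (lookup-index (cover (∈⊤ {x = u})))
    from-injective : ∀ {i j} → from i ≡ from j → i ≡ j
    from-injective {i} {j} = lookup-injective (pentagon-unique P) i j
    -- Adjacency in `cycle 5` is settled by evaluating its decision procedure; the implicit argument
    -- is solved automatically for each pair of vertices.
    edge : ∀ i j → {True (Graph._~?_ (cycle 5) i j)} → from i ~ from j →
           from i ~ from j ⇔ Graph._~_ (cycle 5) i j
    edge i j {t} i~j = mk⇔ (λ _ → toWitness t) (λ _ → i~j)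
    non-edge : ∀ i j → {False (Graph._~?_ (cycle 5) i j)} → ¬ from i ~ from j →
               from i ~ from j ⇔ Graph._~_ (cycle 5) i j
    non-edge i j {f} i≁j = mk⇔ (λ i~j → contradiction i~j i≁j) (λ i~j → contradiction i~j (toWitnessFalse f))
    adjacent : ∀ i j → from i ~ from j ⇔ Graph._~_ (cycle 5) i j
    adjacent 0F 0F = non-edge 0F 0F (~-irrefl refl)
    adjacent 0F 1F = edge 0F 1F ab
    adjacent 0F 2F = non-edge 0F 2F ac
    adjacent 0F 3F = non-edge 0F 3F (da ∘ ~-sym)
    adjacent 0F 4F = edge 0F 4F (~-sym ea)
    adjacent 1F 0F = edge 1F 0F (~-sym ab)
    adjacent 1F 1F = non-edge 1F 1F (~-irrefl refl)
    adjacent 1F 2F = edge 1F 2F bc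
    adjacent 1F 3F = non-edge 1F 3F bd
    adjacent 1F 4F = non-edge 1F 4F (eb ∘ ~-sym)
    adjacent 2F 0F = non-edge 2F 0F (ac ∘ ~-sym)
    adjacent 2F 1F = edge 2F 1F (~-sym bc)
    adjacent 2F 2F = non-edge 2F 2F (~-irrefl refl)
    adjacent 2F 3F = edge 2F 3F cd
    adjacent 2F 4F = non-edge 2F 4F ce
    adjacent 3F 0F = non-edge 3F 0F da
    adjacent 3F 1F = non-edge 3F 1F (bd ∘ ~-sym)
    adjacent 3F 2F = edge 3F 2F (~-sym cd)
    adjacent 3F 3F = non-edge 3F 3F (~-irrefl refl)
    adjacent 3F 4F = edge 3F 4F de
    adjacent 4F 0F = edge 4F 0F ea
    adjacent 4F 1F = non-edge 4F 1F eb
    adjacent 4F 2F = non-edge 4F 2F (ce ∘ ~-sym)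
    adjacent 4F 3F = edge 4F 3F (~-sym de)
    adjacent 4F 4F = non-edge 4F 4F (~-irrefl refl)

  spec⊤⇒special : Spec ⊤ → Special G k
  spec⊤⇒special (inj₁ (n≡k , adj)) =
    inj₁ (complete-≅ G (trans (sym (∣⊤∣≡n n)) n≡k) λ u v u≢v → adj ∈⊤ ∈⊤ u≢v)
  spec⊤⇒special (inj₂ (k≡2 , _ , _ , _ , _ , _ , P)) = inj₂ (k≡2 , pentagon-≅ P)

  spec-nonempty : ∀ {C} → Spec C → Nonempty C
  spec-nonempty (inj₁ (∣C∣≡k , _)) = 0<∣p∣⇒nonempty (subst (0 <_) (sym ∣C∣≡k) 1≤k)
  spec-nonempty (inj₂ (_ , _ , _ , _ , _ , _ , _ , _ , _ , a∈C ∷ _)) = _ , a∈C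

  -- Following paths from a vertex of a nonempty closed set reaches every vertex, so a special
  -- component of the whole graph is the whole graph.
  connected⇒noSpec⊤ : Connected G → ¬ Special G k → NoSpec ⊤
  connected⇒noSpec⊤ (_ , paths) ¬special {C} (spec , C⊆ , closed) with spec-nonempty spec
  ... | w , w∈C = ¬special (spec⊤⇒special (subst Spec (⊆-antisym C⊆ λ {u} _ → along (paths w u) w∈C) spec))
    where
    along : ∀ {u v} → Star _~_ u v → u ∈ C → v ∈ C
    along ε              u∈C = u∈C
    along (u~z ◅ z⋯v) u∈C = along z⋯v (closed u∈C ∈⊤ u~z)

  small-isolating : Connected G → ¬ Special G k → ∃[ D ] Free (_∈ Rest D) × ∣ D ∣ ≤ n / suc k
  small-isolating connected ¬special
    with upper-bound (<-wellFounded _) (connected⇒noSpec⊤ connected ¬special)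
  ... | D , count , free = ⟪ ∈D? ⟫ ,
    free-mono (λ u∈ → ∈⊤ , tt , All.tabulate λ d∈D u∈N →
      x∈∁p⇒x∉p u∈ (∈N⟦⟧⁺ G ⟪ ∈D? ⟫ (∈⟪⟫⁺ ∈D? d∈D) u∈N)) free ,
    (begin
      -- Repetitions in the list `D` can only make the set smaller.
      ∣ ⟪ ∈D? ⟫ ∣                  ≤⟨ ∣∣≤length D (∈⟪⟫⁻ ∈D?) ⟩
      length D                     ≡⟨ sym (m*n/n≡m (length D) (suc k)) ⟩
      length D * suc k / suc k     ≤⟨ /-monoˡ-≤ (suc k) (≤-trans (≤-reflexive (*-comm (length D) (suc k))) count) ⟩
      ∣ ⊤ {n} ∣ / suc k            ≡⟨ cong (_/ suc k) (∣⊤∣≡n n) ⟩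
      n / suc k                    ∎)
    where
    open ≤-Reasoning
    ∈D? : Decidable (_∈ˡ D)
    ∈D? u = ∈ˡ-dec _≟ᶠ_ u D

  -- The lower bound for `B n k`.

  B-lower-bound : G ≅ B n k → ∀ {D} → Free (_∈ Rest D) → n / suc k ≤ ∣ D ∣
  B-lower-bound (φ , φ-~) {D} free = ≤-trans (≤-reflexive (sym (∣⊤∣≡n (n / suc k))))
    -- Each of the `n / suc k` full blocks contains a vertex of `D`; blocks being disjoint, these
    -- vertices are distinct.
    (∣∣-injection hitter ⊤ D (λ {i} {j} _ _ eq →
      Finₚ.toℕ-injective (trans (sym (hitter-block i)) (trans (cong blk eq) (hitter-block j))))
      λ {i} _ → proj₁ (proj₂ (hit i)))
    where
    blk pos : Fin n → ℕ
    blk u = block n k (Inverse.to φ u)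
    pos u = position n k (Inverse.to φ u)

    to-injective : ∀ {u v} → Inverse.to φ u ≡ Inverse.to φ v → u ≡ v
    to-injective {u} {v} eq = trans (sym (Inverse.strictlyInverseʳ φ u))
      (trans (cong (Inverse.from φ) eq) (Inverse.strictlyInverseʳ φ v))

    same-block : ∀ {u v} → u ≢ v → blk u ≡ blk v → u ~ v
    same-block u≢v eq = Equivalence.from (φ-~ _ _) ((u≢v ∘ to-injective) , inj₁ (inj₁ eq))

    -- Edges between different blocks join vertices of position `0` only.
    ~⇒same-block : ∀ {u v} → u ~ v → pos v ≢ 0 → blk u ≡ blk v
    ~⇒same-block u~v pos≢0 with Equivalence.to (φ-~ _ _) u~v
    ... | _ , inj₁ (inj₁ eq)            = eq
    ... | _ , inj₁ (inj₂ (_ , v≡0 , _)) = contradiction v≡0 pos≢0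
    ... | _ , inj₂ (inj₁ eq)            = sym eq
    ... | _ , inj₂ (inj₂ (v≡0 , _ , _)) = contradiction v≡0 pos≢0

    module _ (i : Fin (n / suc k)) where

      inner? : Decidable (λ u → blk u ≡ toℕ i × pos u ≢ 0)
      inner? u = (blk u ≟ toℕ i) ×-dec ¬? (pos u ≟ 0)

      offset : Fin k → ℕ
      -- The `suc` skips position `0`, that of the chosen vertex of block `i`.
      offset j = suc (toℕ j) + toℕ i * suc k

      offset<n : ∀ j → offset j < n
      offset<n j = begin
        suc (suc (toℕ j) + toℕ i * suc k)   ≤⟨ +-monoˡ-≤ (toℕ i * suc k) (s≤s (Finₚ.toℕ<n j)) ⟩
        suc (toℕ i) * suc k                 ≤⟨ *-monoˡ-≤ (suc k) (Finₚ.toℕ<n i) ⟩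
        (n / suc k) * suc k                 ≤⟨ m/n*n≤m n (suc k) ⟩
        n                                   ∎
        where open ≤-Reasoning

      point : Fin k → Fin n
      point j = Inverse.from φ (fromℕ< (offset<n j))

      to-point : ∀ j → toℕ (Inverse.to φ (point j)) ≡ offset j
      to-point j = trans (cong toℕ (Inverse.strictlyInverseˡ φ _)) (Finₚ.toℕ-fromℕ< (offset<n j))

      pos-point : ∀ j → pos (point j) ≡ suc (toℕ j)
      pos-point j = trans (cong (_% suc k) (to-point j))
        (trans ([m+kn]%n≡m%n (suc (toℕ j)) (toℕ i) (suc k)) (m<n⇒m%n≡m (s≤s (Finₚ.toℕ<n j))))

      blk-point : ∀ j → blk (point j) ≡ toℕ i
      blk-point j = begin
        blk (point j)                                             ≡⟨ cong (_/ suc k) (to-point j) ⟩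
        (suc (toℕ j) + toℕ i * suc k) / suc k                     ≡⟨ +-distrib-/-∣ʳ (suc (toℕ j)) (divides-refl (toℕ i)) ⟩
        suc (toℕ j) / suc k + toℕ i * suc k / suc k               ≡⟨ cong₂ _+_ (m<n⇒m/n≡0 (s≤s (Finₚ.toℕ<n j))) (m*n/n≡m (toℕ i) (suc k)) ⟩
        toℕ i                                                     ∎
        where open ≡-Reasoning

      point-∈ : ∀ j → point j ∈ ⟪ inner? ⟫
      point-∈ j = ∈⟪⟫⁺ inner? (blk-point j , λ pos≡0 → contradiction (trans (sym (pos-point j)) pos≡0) λ ())

      k≤∣inner∣ : k ≤ ∣ ⟪ inner? ⟫ ∣
      k≤∣inner∣ = ≤-trans (≤-reflexive (sym (∣⊤∣≡n k)))
        (∣∣-injection point ⊤ ⟪ inner? ⟫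
          (λ {a} {b} _ _ eq → Finₚ.toℕ-injective (suc-injective
            (trans (sym (pos-point a)) (trans (cong pos eq) (pos-point b)))))
          λ {j} _ → point-∈ j)

      inner-bad : Bad ⟪ inner? ⟫
      inner-bad = inj₂ (0<∣p∣⇒nonempty (≤-trans 1≤k k≤∣inner∣) , λ {v} v∈ →
        ≤-trans k≤∣inner∣ (≤-trans (∣p∣≤1+∣p∖u∣ ⟪ inner? ⟫ v) (s≤s (p⊆q⇒∣p∣≤∣q∣ λ u∈ →
          let u∈S , u∉v = ∈∖⁻ ⟪ inner? ⟫ ⁅ v ⁆ u∈ in
          ∈S∩N u∈S (same-block (λ { refl → u∉v (x∈⁅x⁆ v) })
            (trans (proj₁ (∈⟪⟫⁻ inner? v∈)) (sym (proj₁ (∈⟪⟫⁻ inner? u∈S)))))))))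

      hit : ∃[ d ] d ∈ D × blk d ≡ toℕ i
      hit with any? (λ d → (d ∈? D) ×-dec (blk d ≟ toℕ i))
      ... | yes found = found
      -- If `D` missed the block, its `k` inner vertices would all survive, and they form a clique,
      -- which is bad.
      ... | no  none  = contradiction inner-bad (free ⟪ inner? ⟫ λ u∈ → x∉p⇒x∈∁p λ u∈N → dominated (∈⟪⟫⁻ inner? u∈) (∈N⟦⟧⁻ G D u∈N))
        where
        dominated : ∀ {u} → blk u ≡ toℕ i × pos u ≢ 0 → ¬ (∃[ d ] d ∈ D × u ∈ N[ G ∣ d ])
        dominated (blk≡i , pos≢0) (d , d∈D , u∈N) with ∈N[]⁻ u∈N
        ... | inj₁ refl = none (d , d∈D , blk≡i)
        ... | inj₂ d~u  = none (d , d∈D , trans (~⇒same-block d~u pos≢0) blk≡i)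

      hitter : Fin n
      hitter = proj₁ hit

      hitter-block : blk hitter ≡ toℕ i
      hitter-block = proj₂ (proj₂ hit)

theorem4 : (k n : ℕ) .{{_ : NonZero k}} (G : Graph (Fin n)) →
    Connected G → ¬ Special G k →
    ∃[ m ] (ι[ G , 𝓕 k ]≡ m) × m ≤ n / suc k × (G ≅ B n k → m ≡ n / suc k)
theorem4 k n G connected ¬special =
  let open IsolatingSets G k
      D₀ , free₀ , ∣D₀∣≤ = small-isolating connected ¬special
      -- Freeness of the remainder is equivalent to isolation, so the smallest set found by
      -- descending from `D₀` attains the minimum and inherits the upper bound.
      D , free , ∣D∣≤∣D₀∣ , least = smallest rest-free? D₀ (<-wellFounded _) free₀
      ∣D∣≤ = ≤-trans ∣D∣≤∣D₀∣ ∣D₀∣≤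
  in ∣ D ∣
   , record
       { attained = D , free⇒isolating free , refl
       ; minimum  = λ E isolating → least E (isolating⇒free isolating)
       }
   , ∣D∣≤
   , λ iso → ≤-antisym ∣D∣≤ (B-lower-bound iso free)
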